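{- Let $\Gamma$ be a connected strongly regular graph with parameters $(v,k,\lambda,\mu)$, with Laplacian $L$, whose two distinct nonzero Laplacian eigenvalues $r$ and $s$ are integers, with multiplicities $f$ and $g$ respectively. Let $p$ be a prime dividing $|K(\Gamma)|$, and let $e_0$ denote the rank of $L$ over the field with $p$ elements. Suppose $p \parallel r$ and $p \parallel s$, and let $\gamma$ be the unique nonnegative integer with $p^\gamma \parallel v$. Then \[ K_p(\Gamma) \cong (\mathbb{Z}/p\mathbb{Z})^{f+g+\gamma-2e_0} \oplus (\mathbb{Z}/p^2\mathbb{Z})^{e_0-\gamma}. \]
   Context: A graph is strongly regular with parameters $(v,k,\lambda,\mu)$ if it has $v$ vertices, is $k$-regular, any two adjacent vertices have exactly $\lambda$ common neighbours, and any two non-adjacent vertices have exactly $\mu$ common neighbours. The Laplacian is $L = kI - A$ with $A$ the adjacency matrix. For a connected strongly regular graph (not complete), $0$ is a simple eigenvalue of $L$ and $L$ has exactly two other distinct eigenvalues $r,s$. Viewing $L$ as a map $\mathbb{Z}^{\mathcal{V}} \to \mathbb{Z}^{\mathcal{V}}$, its cokernel decomposes as $K(\Gamma) \oplus \mathbb{Z}$ with $K(\Gamma)$ finite, the critical group. $K_p(\Gamma)$ denotes the Sylow $p$-subgroup of $K(\Gamma)$. $p^i \parallel n$ means $p^i \mid n$ and $p^{i+1} \nmid n$. -}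

module Defs where

open import Data.Nat as ℕ using (ℕ; zero; suc)
open import Data.Nat.Divisibility as ℕD using ()
open import Data.Integer as ℤ using (ℤ; +_; -_)
open import Data.Integer.Divisibility as ℤD using ()
open import Data.Rational as ℚ using (ℚ)
open import Data.Fin using (Fin; zero; suc)
open import Data.Fin.Properties using () renaming (_≟_ to _≟ᶠ_)
open import Data.Bool using (Bool; true; false; if_then_else_)
open import Data.Product using (Σ; ∃; _×_; _,_)
open import Relation.Nullary using (¬_; does)
open import Relation.Binary.PropositionalEquality using (_≡_; _≢_)

sumF : {A : Set} → A → (A → A → A) → {n : ℕ} → (Fin n → A) → A
sumF z _⊕_ {zero}  f = z
sumF z _⊕_ {suc n} f = f zero ⊕ sumF z _⊕_ (λ i → f (suc i))

-- Elementary linear algebra over a field presented by a carrier,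
-- 0, +, * and an equality relation _≈_ (a field's equality).
-- Vectors of length n are functions Fin n → A, matrices Fin m → Fin n → A.

module LinAlg {A : Set} (0# : A) (_⊕_ _⊗_ : A → A → A) (_≈_ : A → A → Set) where

  IsZeroVec : {n : ℕ} → (Fin n → A) → Set
  IsZeroVec w = ∀ i → w i ≈ 0#

  linComb : {m n : ℕ} → (Fin m → A) → (Fin m → Fin n → A) → Fin n → A
  linComb c w j = sumF 0# _⊕_ (λ i → c i ⊗ w i j)

  Independent : {m n : ℕ} → (Fin m → Fin n → A) → Set
  Independent w = ∀ c → IsZeroVec (linComb c w) → ∀ i → c i ≈ 0#

  HasDim : {n : ℕ} → ((Fin n → A) → Set) → ℕ → Set
  HasDim {n} S d =
    (Σ (Fin d → Fin n → A) λ w → (∀ i → S (w i)) × Independent w)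
    × (∀ (w : Fin (suc d) → Fin n → A) → (∀ i → S (w i)) → ¬ Independent w)

  mulMV : {m n : ℕ} → (Fin m → Fin n → A) → (Fin n → A) → Fin m → A
  mulMV M x i = sumF 0# _⊕_ (λ j → M i j ⊗ x j)

  Kernel : {m n : ℕ} → (Fin m → Fin n → A) → (Fin n → A) → Set
  Kernel M x = IsZeroVec (mulMV M x)

  ColumnSpace : {m n : ℕ} → (Fin m → Fin n → A) → (Fin m → A) → Set
  ColumnSpace M y = Σ _ λ x → ∀ i → y i ≈ mulMV M x i

  Rank : {m n : ℕ} → (Fin m → Fin n → A) → ℕ → Set
  Rank M e = HasDim (ColumnSpace M) e

module LinQ = LinAlg ℚ.0ℚ ℚ._+_ ℚ._*_ _≡_

-- the field 𝔽_p, represented by integers with equality = congruence mod p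
_≡[mod_]_ : ℤ → ℕ → ℤ → Set
a ≡[mod p ] b = (+ p) ℤD.∣ (a ℤ.- b)

module LinFp (p : ℕ) = LinAlg (+ 0) ℤ._+_ ℤ._*_ (λ a b → a ≡[mod p ] b)

Graph : ℕ → Set
Graph v = Fin v → Fin v → Bool

b2ℕ : Bool → ℕ
b2ℕ true  = 1
b2ℕ false = 0

b2ℤ : Bool → ℤ
b2ℤ true  = + 1
b2ℤ false = + 0

IsSimple : {v : ℕ} → Graph v → Set
IsSimple {v} G = (∀ i j → G i j ≡ G j i) × (∀ i → G i i ≡ false)

degree : {v : ℕ} → Graph v → Fin v → ℕ
degree G i = sumF 0 ℕ._+_ (λ j → b2ℕ (G i j))

commonNbrs : {v : ℕ} → Graph v → Fin v → Fin v → ℕ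
commonNbrs G i j = sumF 0 ℕ._+_ (λ l → b2ℕ (G i l) ℕ.* b2ℕ (G j l))

IsSRG : {v : ℕ} → Graph v → ℕ → ℕ → ℕ → Set
IsSRG {v} G k λ' μ =
  IsSimple G
  × (∀ i → degree G i ≡ k)
  × (∀ i j → i ≢ j → G i j ≡ true  → commonNbrs G i j ≡ λ')
  × (∀ i j → i ≢ j → G i j ≡ false → commonNbrs G i j ≡ μ)

data Reachable {v : ℕ} (G : Graph v) : Fin v → Fin v → Set where
  here : ∀ {i} → Reachable G i i
  step : ∀ {i j l} → G i j ≡ true → Reachable G j l → Reachable G i l

Connected : {v : ℕ} → Graph v → Set
Connected G = ∀ i j → Reachable G i j

laplacian : {v : ℕ} → Graph v → ℕ → Fin v → Fin v → ℤ
laplacian G k i j = (if does (i ≟ᶠ j) then + k else + 0) ℤ.- b2ℤ (G i j)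

shiftedLapℚ : {v : ℕ} → Graph v → ℕ → ℤ → Fin v → Fin v → ℚ
shiftedLapℚ G k r i j =
  ((laplacian G k i j) ℚ./ 1) ℚ.- (if does (i ≟ᶠ j) then r ℚ./ 1 else ℚ.0ℚ)

EigenMult : {v : ℕ} → Graph v → ℕ → ℤ → ℕ → Set
EigenMult G k r f = LinQ.HasDim (LinQ.Kernel (shiftedLapℚ G k r)) f

RankModP : {v : ℕ} → Graph v → ℕ → ℕ → ℕ → Set
RankModP G k p e = LinFp.Rank p (laplacian G k) e

module LinZ = LinAlg (+ 0) ℤ._+_ ℤ._*_ _≡_

ZVec : ℕ → Set
ZVec v = Fin v → ℤ

scale : {v : ℕ} → ℤ → ZVec v → ZVec v
scale m x i = m ℤ.* x i

addV : {v : ℕ} → ZVec v → ZVec v → ZVec v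
addV x y i = x i ℤ.+ y i

subV : {v : ℕ} → ZVec v → ZVec v → ZVec v
subV x y i = x i ℤ.- y i

InImL : {v : ℕ} → Graph v → ℕ → ZVec v → Set
InImL G k x = LinZ.ColumnSpace (laplacian G k) x

-- equality in coker L
_~[_,_]_ : {v : ℕ} → ZVec v → Graph v → ℕ → ZVec v → Set
x ~[ G , k ] y = InImL G k (subV x y)

-- the class of x is a torsion element of coker L, i.e. lies in K(Γ)
IsTorsion : {v : ℕ} → Graph v → ℕ → ZVec v → Set
IsTorsion G k x = Σ ℤ λ m → (m ≢ + 0) × InImL G k (scale m x)

-- the class of x lies in K_p(Γ) (killed by a power of p)
IsPTorsion : {v : ℕ} → Graph v → ℕ → ℕ → ZVec v → Set
IsPTorsion G k p x = Σ ℕ λ j → InImL G k (scale (+ (p ℕ.^ j)) x)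

CritOrder : {v : ℕ} → Graph v → ℕ → ℕ → Set
CritOrder {v} G k n =
  Σ (Fin n → ZVec v) λ h →
    (∀ a → IsTorsion G k (h a))
    × (∀ a b → h a ~[ G , k ] h b → a ≡ b)
    × (∀ x → IsTorsion G k x → Σ (Fin n) λ a → h a ~[ G , k ] x)

-- The group (ℤ/pℤ)^a ⊕ (ℤ/p²ℤ)^b

Target : ℕ → ℕ → Set
Target a b = (Fin a → ℤ) × (Fin b → ℤ)

_≈T[_]_ : {a b : ℕ} → Target a b → ℕ → Target a b → Set
(x₁ , y₁) ≈T[ p ] (x₂ , y₂) =
  (∀ i → x₁ i ≡[mod p ] x₂ i) × (∀ i → y₁ i ≡[mod (p ℕ.* p) ] y₂ i)

addT : {a b : ℕ} → Target a b → Target a b → Target a b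
addT (x₁ , y₁) (x₂ , y₂) = (λ i → x₁ i ℤ.+ x₂ i) , (λ i → y₁ i ℤ.+ y₂ i)

-- K_p(Γ) ≅ (ℤ/pℤ)^a ⊕ (ℤ/p²ℤ)^b : a group isomorphism φ from the
-- right-hand side onto K_p(Γ) (both taken as setoid groups)
SylowIso : {v : ℕ} → Graph v → ℕ → ℕ → ℕ → ℕ → Set
SylowIso {v} G k p a b =
  Σ (Target a b → ZVec v) λ φ →
    (∀ t → IsPTorsion G k p (φ t))
    × (∀ t t' → t ≈T[ p ] t' → φ t ~[ G , k ] φ t')
    × (∀ t t' → φ (addT t t') ~[ G , k ] addV (φ t) (φ t'))
    × (∀ t t' → φ t ~[ G , k ] φ t' → t ≈T[ p ] t')
    × (∀ x → IsPTorsion G k p x → Σ (Target a b) λ t → φ t ~[ G , k ] x)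

{-# OPTIONS --safe #-}
module Submission where

-- Let T be the Laplacian acting on ℤ^v and 𝟙 the all-one vector. Strong regularity gives
-- T² = (r + s) T - r s I + μ J with r s = μ v = p² u, where p ∤ u and p ∣ r + s. Filter 𝔽_p^v by the
-- reductions mod p of M_i = T⁻¹(p^i ℤ^v). By the quadratic relation, M_3 reduces to ⟨𝟙⟩ and M_2 to
-- ⟨𝟙⟩ + T(sum-zero vectors), while M_1 reduces to ker T, of dimension v - e₀. Take a basis adapted to
-- M_3 ⊆ M_2 ⊆ M_1 ⊆ 𝔽_p^v, omit 𝟙, apply T and divide by p², p or 1: the result is a basis mod p of the
-- sum-zero vectors, and it exhibits K_p as (ℤ/p)^a ⊕ (ℤ/p²)^b with b = dim M_2 - 1 and
-- a = dim M_1 - dim M_2. To see b = e₀ - γ, compare T(sum-zero vectors) with the column space of T mod p: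
-- the dimension depends on whether ker T lies in the sum-zero vectors and whether 𝟙 lies in
-- T(sum-zero vectors). For γ = 0 and γ = 2 both questions are settled by the quadratic relation; for γ = 1
-- the answers are opposite to each other, which is enough. Finally v = f + g + 1, because ℚ^v is the
-- direct sum of ⟨𝟙⟩ and the two eigenspaces.

open import Defs
open import Algebra.Bundles using (CommutativeRing)
open import Data.Nat as ℕ using (ℕ; zero; suc; z≤n; s≤s)
import Data.Nat.Properties as ℕₚ
import Data.Nat.Divisibility as ℕD
open import Data.Nat.Coprimality using (Coprime; coprime-Bézout)
open import Data.Nat.GCD using (module Bézout)
open import Data.Nat.Primality using (Prime; prime⇒irreducible; prime⇒nonZero; ¬prime[1])
open import Data.Integer as ℤ using (ℤ; +_)
import Data.Integer.Properties as ℤₚ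
import Data.Integer.Divisibility as ℤD
open import Data.Integer.Divisibility using () renaming (_∣_ to _∣ℤ_)
import Data.Integer.Divisibility.Signed as ℤS
open import Data.Integer.Tactic.RingSolver using (solve-∀)
open import Data.Rational as ℚ using (ℚ; 0ℚ; 1ℚ; toℚᵘ)
import Data.Rational.Properties as ℚₚ
import Data.Rational.Solver
open import Data.Rational.Unnormalised as ℚᵘ using (mkℚᵘ; *≡*)
import Data.Rational.Unnormalised.Properties as ℚᵘₚ
open import Data.Bool using (Bool; true; false; if_then_else_)
open import Data.Fin using (Fin; zero; suc; _↑ˡ_; _↑ʳ_; splitAt; join; punchIn; punchOut)
open import Data.Fin.Properties using (any?; punchIn-punchOut; join-splitAt) renaming (_≟_ to _≟ᶠ_)
open import Data.Vec.Functional using (_∷_; _++_)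
open import Data.Vec.Functional.Properties using (lookup-++ˡ; lookup-++ʳ)
open import Data.Product using (Σ; ∃; _×_; _,_; proj₁; proj₂)
open import Data.Sum using (_⊎_; inj₁; inj₂)
open import Data.Empty using (⊥-elim)
open import Function using (_∘_)
open import Level using (0ℓ)
open import Relation.Nullary using (¬_; Dec; yes; no; does)
open import Relation.Nullary.Decidable using (¬?; decidable-stable; map′; dec-true; dec-false)
open import Relation.Binary.PropositionalEquality as ≡ using (_≡_; _≢_)

-- The argument stays over ℤ and never localizes at p. What replaces localization is that, for `y`
-- of sum zero, the quadratic relation reads u p² y = T (p τ y - T y), where p τ = r + s: up to the
-- factor u, which is prime to p, every p² y is in the image. So expanding a sum-zero vector twice
-- in a basis mod p, with a remainder p² y of sum zero, is precise enough, and no basis of a lattice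
-- is ever constructed. Read in the other direction, the relation bounds the filtration: if T x = p²
-- y, then u x differs from p τ y - T y by a constant vector, and if y is itself divisible by p,
-- only the constant vector is left mod p. This is why no nonzero elementary divisor is divisible by
-- p³. The adapted basis mod p has to consist of integer vectors whose images really are divisible
-- by p or p², since the quotients are used; each extension therefore selects its vectors from a
-- family with that property. The rank is given through a maximality clause that is only a negation,
-- so spanning statements come from decidable Gaussian elimination.

-- Finite sums, linear combinations and matrix action over a commutative ring.

module Sums (R : CommutativeRing 0ℓ 0ℓ) where
  open CommutativeRing R hiding (zero)
  open import Relation.Binary.Reasoning.Setoid setoid
  open import Algebra.Properties.CommutativeSemigroup +-commutativeSemigroup using (interchange)
  open LinAlg 0# _+_ _*_ _≈_ public

  ∑ : ∀ {n} → (Fin n → Carrier) → Carrier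
  ∑ = sumF 0# _+_

  δ : ∀ {n} → Fin n → Fin n → Carrier
  δ i j = if does (i ≟ᶠ j) then 1# else 0#

  ∑-cong : ∀ {n} {f g : Fin n → Carrier} → (∀ i → f i ≈ g i) → ∑ f ≈ ∑ g
  ∑-cong {zero}  f≈g = refl
  ∑-cong {suc n} f≈g = +-cong (f≈g zero) (∑-cong (f≈g ∘ suc))

  ∑-zero : ∀ {n} {f : Fin n → Carrier} → (∀ i → f i ≈ 0#) → ∑ f ≈ 0#
  ∑-zero {zero}  f≈0 = refl
  ∑-zero {suc n} f≈0 = trans (+-cong (f≈0 zero) (∑-zero (f≈0 ∘ suc))) (+-identityˡ 0#)

  ∑-+ : ∀ {n} (f g : Fin n → Carrier) → ∑ (λ i → f i + g i) ≈ ∑ f + ∑ g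
  ∑-+ {zero}  f g = sym (+-identityˡ 0#)
  ∑-+ {suc n} f g = trans (+-congˡ (∑-+ (f ∘ suc) (g ∘ suc)))
    (interchange (f zero) (g zero) (∑ (f ∘ suc)) (∑ (g ∘ suc)))

  ∑-*ˡ : ∀ {n} a (f : Fin n → Carrier) → ∑ (λ i → a * f i) ≈ a * ∑ f
  ∑-*ˡ {zero}  a f = sym (zeroʳ a)
  ∑-*ˡ {suc n} a f = trans (+-congˡ (∑-*ˡ a (f ∘ suc))) (sym (distribˡ a (f zero) _))

  ∑-*ʳ : ∀ {n} a (f : Fin n → Carrier) → ∑ (λ i → f i * a) ≈ ∑ f * a
  ∑-*ʳ a f = trans (∑-cong (λ i → *-comm (f i) a)) (trans (∑-*ˡ a f) (*-comm a _))

  ∑-swap : ∀ {m n} (f : Fin m → Fin n → Carrier) →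
           ∑ (λ i → ∑ (f i)) ≈ ∑ (λ j → ∑ (λ i → f i j))
  ∑-swap {zero} {n} f = sym (∑-zero {n} {λ _ → 0#} (λ _ → refl))
  ∑-swap {suc m} f = trans (+-congˡ (∑-swap (f ∘ suc)))
    (sym (∑-+ (f zero) (λ j → ∑ (λ i → f (suc i) j))))

  ∑-++ : ∀ m {n} (f : Fin (m ℕ.+ n) → Carrier) →
         ∑ f ≈ ∑ (λ i → f (i ↑ˡ n)) + ∑ (λ i → f (m ↑ʳ i))
  ∑-++ zero    f = sym (+-identityˡ _)
  ∑-++ (suc m) f = trans (+-congˡ (∑-++ m (f ∘ suc))) (sym (+-assoc _ _ _))

  ∑-δ : ∀ {n} i (f : Fin n → Carrier) → ∑ (λ j → δ i j * f j) ≈ f i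
  ∑-δ zero f = trans (+-cong (*-identityˡ _) (∑-zero (λ j → zeroˡ (f (suc j))))) (+-identityʳ _)
  ∑-δ (suc i) f = trans (+-cong (zeroˡ _) (∑-δ i (f ∘ suc))) (+-identityˡ _)

  δ-sym : ∀ {n} (i j : Fin n) → δ i j ≈ δ j i
  δ-sym zero zero = refl
  δ-sym zero (suc j) = refl
  δ-sym (suc i) zero = refl
  δ-sym (suc i) (suc j) = δ-sym i j

  module _ {m n : ℕ} where

    linComb-congˡ : {c d : Fin m → Carrier} (w : Fin m → Fin n → Carrier) → (∀ i → c i ≈ d i) →
                    ∀ j → linComb c w j ≈ linComb d w j
    linComb-congˡ w c≈d j = ∑-cong (λ i → *-congʳ (c≈d i))

    linComb-congʳ : (c : Fin m → Carrier) {w u : Fin m → Fin n → Carrier} → (∀ i j → w i j ≈ u i j) →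
                    ∀ j → linComb c w j ≈ linComb c u j
    linComb-congʳ c w≈u j = ∑-cong (λ i → *-congˡ (w≈u i j))

    linComb-+ : ∀ c d (w : Fin m → Fin n → Carrier) j →
                linComb (λ i → c i + d i) w j ≈ linComb c w j + linComb d w j
    linComb-+ c d w j = trans (∑-cong (λ i → distribʳ (w i j) (c i) (d i)))
                          (∑-+ (λ i → c i * w i j) (λ i → d i * w i j))

    linComb-*ˡ : ∀ a c (w : Fin m → Fin n → Carrier) j →
                 linComb (λ i → a * c i) w j ≈ a * linComb c w j
    linComb-*ˡ a c w j = trans (∑-cong (λ i → *-assoc a (c i) (w i j))) (∑-*ˡ a (λ i → c i * w i j))

    linComb-zero : ∀ {c} (w : Fin m → Fin n → Carrier) → (∀ i → c i ≈ 0#) →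
                   IsZeroVec (linComb c w)
    linComb-zero w c≈0 j = ∑-zero (λ i → trans (*-congʳ (c≈0 i)) (zeroˡ (w i j)))

    linComb-*ʳ : ∀ a c (w : Fin m → Fin n → Carrier) j →
                 linComb c (λ i j → a * w i j) j ≈ a * linComb c w j
    linComb-*ʳ a c w j = trans (∑-cong (λ i → trans (sym (*-assoc (c i) a (w i j)))
                           (trans (*-congʳ (*-comm (c i) a)) (*-assoc a (c i) (w i j)))))
                             (∑-*ˡ a (λ i → c i * w i j))

    linComb-δ : ∀ (w : Fin m → Fin n → Carrier) i j → linComb (δ i) w j ≈ w i j
    linComb-δ w i j = ∑-δ i (λ i → w i j)

    ∑-linComb : ∀ c (w : Fin m → Fin n → Carrier) →
                ∑ (linComb c w) ≈ ∑ (λ i → c i * ∑ (w i))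
    ∑-linComb c w = trans (∑-swap (λ j i → c i * w i j)) (∑-cong (λ i → ∑-*ˡ (c i) (w i)))

  linComb-linComb : ∀ {l m n} c (C : Fin l → Fin m → Carrier) (w : Fin m → Fin n → Carrier) j →
                    linComb c (λ i → linComb (C i) w) j ≈ linComb (linComb c C) w j
  linComb-linComb c C w j = begin
    ∑ (λ i → c i * ∑ (λ k → C i k * w k j))    ≈⟨ ∑-cong (λ i → ∑-*ˡ (c i) (λ k → C i k * w k j)) ⟨
    ∑ (λ i → ∑ (λ k → c i * (C i k * w k j)))  ≈⟨ ∑-swap (λ i k → c i * (C i k * w k j)) ⟩
    ∑ (λ k → ∑ (λ i → c i * (C i k * w k j)))  ≈⟨ ∑-cong (λ k → ∑-cong (λ i → *-assoc (c i) (C i k) (w k j))) ⟨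
    ∑ (λ k → ∑ (λ i → c i * C i k * w k j))    ≈⟨ ∑-cong (λ k → ∑-*ʳ (w k j) (λ i → c i * C i k)) ⟩
    ∑ (λ k → linComb c C k * w k j)            ∎

  linComb-++ : ∀ {m m′ n} c (u : Fin m → Fin n → Carrier) (w : Fin m′ → Fin n → Carrier) j →
               linComb c (u ++ w) j ≈ linComb (λ i → c (i ↑ˡ m′)) u j + linComb (λ i → c (m ↑ʳ i)) w j
  linComb-++ {m} c u w j = trans (∑-++ m (λ i → c i * (u ++ w) i j)) (+-cong
    (∑-cong (λ i → *-congˡ (reflexive (≡.cong-app (lookup-++ˡ u w i) j))))
    (∑-cong (λ i → *-congˡ (reflexive (≡.cong-app (lookup-++ʳ u w i) j)))))

  linComb-++-++ : ∀ {m m′ n} c c′ (u : Fin m → Fin n → Carrier) (w : Fin m′ → Fin n → Carrier) j →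
                  linComb (c ++ c′) (u ++ w) j ≈ linComb c u j + linComb c′ w j
  linComb-++-++ c c′ u w j = trans (linComb-++ (c ++ c′) u w j) (+-cong
    (linComb-congˡ u (λ i → reflexive (lookup-++ˡ c c′ i)) j)
    (linComb-congˡ w (λ i → reflexive (lookup-++ʳ c c′ i)) j))

  mulMV-linComb : ∀ {m n l} (M : Fin m → Fin n → Carrier) c (w : Fin l → Fin n → Carrier) i →
                  mulMV M (linComb c w) i ≈ linComb c (λ k → mulMV M (w k)) i
  mulMV-linComb M c w i = begin
    ∑ (λ j → M i j * ∑ (λ k → c k * w k j))    ≈⟨ ∑-cong (λ j → ∑-*ˡ (M i j) (λ k → c k * w k j)) ⟨
    ∑ (λ j → ∑ (λ k → M i j * (c k * w k j)))  ≈⟨ ∑-swap (λ j k → M i j * (c k * w k j)) ⟩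
    ∑ (λ k → ∑ (λ j → M i j * (c k * w k j)))  ≈⟨ ∑-cong (λ k → ∑-cong (λ j → exch (M i j) (c k) (w k j))) ⟩
    ∑ (λ k → ∑ (λ j → c k * (M i j * w k j)))  ≈⟨ ∑-cong (λ k → ∑-*ˡ (c k) (λ j → M i j * w k j)) ⟩
    ∑ (λ k → c k * mulMV M (w k) i)            ∎
    where
    exch : ∀ x y z → x * (y * z) ≈ y * (x * z)
    exch x y z = trans (sym (*-assoc x y z)) (trans (*-congʳ (*-comm x y)) (*-assoc y x z))

  module _ {m n : ℕ} (M : Fin m → Fin n → Carrier) where

    mulMV-cong : ∀ {x y} → (∀ j → x j ≈ y j) → ∀ i → mulMV M x i ≈ mulMV M y i
    mulMV-cong x≈y i = ∑-cong (λ j → *-congˡ (x≈y j))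

    mulMV-+ : ∀ x y i → mulMV M (λ j → x j + y j) i ≈ mulMV M x i + mulMV M y i
    mulMV-+ x y i = trans (∑-cong (λ j → distribˡ (M i j) (x j) (y j)))
      (∑-+ (λ j → M i j * x j) (λ j → M i j * y j))

    mulMV-* : ∀ a x i → mulMV M (λ j → a * x j) i ≈ a * mulMV M x i
    mulMV-* a x i = trans (∑-cong (λ j → trans (sym (*-assoc (M i j) a (x j)))
                      (trans (*-congʳ (*-comm (M i j) a)) (*-assoc a (M i j) (x j)))))
                        (∑-*ˡ a (λ j → M i j * x j))

  -- `μ * ∑ x` is the all-`μ` matrix applied to `x`, so the hypothesis is M² = τ M + κ I + μ J.
  mulMV-square : ∀ {n} (M : Fin n → Fin n → Carrier) τ κ μ →
                 (∀ i j → ∑ (λ l → M i l * M l j) ≈ τ * M i j + (κ * δ i j + μ)) →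
                 ∀ x i → mulMV M (mulMV M x) i ≈ τ * mulMV M x i + (κ * x i + μ * ∑ x)
  mulMV-square M τ κ μ h x i = begin
    ∑ (λ l → M i l * ∑ (λ j → M l j * x j))
      ≈⟨ ∑-cong (λ l → ∑-*ˡ (M i l) (λ j → M l j * x j)) ⟨
    ∑ (λ l → ∑ (λ j → M i l * (M l j * x j)))
      ≈⟨ ∑-swap (λ l j → M i l * (M l j * x j)) ⟩
    ∑ (λ j → ∑ (λ l → M i l * (M l j * x j)))
      ≈⟨ ∑-cong (λ j → ∑-cong (λ l → *-assoc (M i l) (M l j) (x j))) ⟨
    ∑ (λ j → ∑ (λ l → M i l * M l j * x j))
      ≈⟨ ∑-cong (λ j → trans (∑-*ʳ (x j) (λ l → M i l * M l j)) (*-congʳ (h i j))) ⟩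
    ∑ (λ j → (τ * M i j + (κ * δ i j + μ)) * x j)
      ≈⟨ ∑-cong (λ j → trans (distribʳ (x j) _ _) (+-cong (*-assoc τ (M i j) (x j))
           (trans (distribʳ (x j) _ _) (+-congʳ (*-assoc κ (δ i j) (x j)))))) ⟩
    ∑ (λ j → τ * (M i j * x j) + (κ * (δ i j * x j) + μ * x j))
      ≈⟨ trans (∑-+ (λ j → τ * (M i j * x j)) (λ j → κ * (δ i j * x j) + μ * x j))
           (+-cong (∑-*ˡ τ (λ j → M i j * x j)) (trans (∑-+ (λ j → κ * (δ i j * x j)) (λ j → μ * x j))
             (+-cong (trans (∑-*ˡ κ (λ j → δ i j * x j)) (*-congˡ (∑-δ i x))) (∑-*ˡ μ x)))) ⟩
    τ * mulMV M x i + (κ * x i + μ * ∑ x) ∎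

  -- Symmetry turns zero row sums into zero column sums, and the sum of an image vector is a
  -- combination of column sums.
  ∑-mulMV : ∀ {n} (M : Fin n → Fin n → Carrier) → (∀ i j → M i j ≈ M j i) → (∀ i → ∑ (M i) ≈ 0#) →
            ∀ x → ∑ (mulMV M x) ≈ 0#
  ∑-mulMV M M-sym rows x = trans (∑-swap (λ i j → M i j * x j)) (∑-zero λ j →
    trans (∑-*ʳ (x j) (λ i → M i j))
      (trans (*-congʳ (trans (∑-cong (λ i → M-sym i j)) (rows j))) (zeroˡ (x j))))

-- Linear algebra over a field with decidable equality: elimination, exchange, extension of bases.

record DiscreteField : Set₁ where
  field
    commutativeRing : CommutativeRing 0ℓ 0ℓ
  open CommutativeRing commutativeRing public
  field
    _≈?_    : ∀ x y → Dec (x ≈ y)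
    inverse : ∀ {x} → ¬ x ≈ 0# → Σ Carrier λ y → y * x ≈ 1#
    1≉0     : ¬ 1# ≈ 0#

module LinearAlgebra (F : DiscreteField) where
  open DiscreteField F hiding (zero)
  open Sums commutativeRing public
  open import Relation.Binary.Reasoning.Setoid setoid
  open import Algebra.Properties.Ring ring
    using (-‿distribˡ-*; -‿distribʳ-*; +-inverseʳ-unique; +-inverseˡ-unique)

  Family : ℕ → ℕ → Set
  Family m n = Fin m → Fin n → Carrier

  _≋_ : ∀ {n} → (Fin n → Carrier) → (Fin n → Carrier) → Set
  x ≋ y = ∀ i → x i ≈ y i

  record Span {m n : ℕ} (w : Family m n) (x : Fin n → Carrier) : Set where
    constructor span
    field
      coeffs  : Fin m → Carrier
      expands : x ≋ linComb coeffs w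
  open Span public

  -- An explicit nontrivial relation, constructively stronger than the negation of `Independent`.
  Dependent : ∀ {m n} → Family m n → Set
  Dependent {m} w = Σ (Fin m → Carrier) λ c → IsZeroVec (linComb c w) × ∃ λ i → ¬ c i ≈ 0#

  cancel-unit : ∀ {a x} → ¬ a ≈ 0# → a * x ≈ 0# → x ≈ 0#
  cancel-unit {a} {x} a≉0 ax≈0 with inverse a≉0
  ... | b , ba≈1 = begin
    x            ≈⟨ *-identityˡ x ⟨
    1# * x       ≈⟨ *-congʳ ba≈1 ⟨
    b * a * x    ≈⟨ *-assoc b a x ⟩
    b * (a * x)  ≈⟨ *-congˡ ax≈0 ⟩
    b * 0#       ≈⟨ zeroʳ b ⟩
    0#           ∎

  module _ {m n : ℕ} {w : Family m n} where

    span-resp : ∀ {x y} → x ≋ y → Span w x → Span w y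
    span-resp x≋y (span c eq) = span c λ j → trans (sym (x≋y j)) (eq j)

    span-+ : ∀ {x y} → Span w x → Span w y → Span w (λ j → x j + y j)
    span-+ (span c x≋) (span d y≋) = span (λ i → c i + d i) λ j → trans (+-cong (x≋ j) (y≋ j))
      (sym (linComb-+ c d w j))

    span-* : ∀ a {x} → Span w x → Span w (λ j → a * x j)
    span-* a (span c x≋) = span (λ i → a * c i) λ j → trans (*-congˡ (x≋ j)) (sym (linComb-*ˡ a c w j))

    span-∈ : ∀ i → Span w (w i)
    span-∈ i = span (δ i) λ j → sym (linComb-δ w i j)

    span-unscale : ∀ {a x} → ¬ a ≈ 0# → Span w (λ j → a * x j) → Span w x
    span-unscale {a} {x} a≉0 sp with inverse a≉0
    ... | b , ba≈1 = span-resp (λ j → trans (sym (*-assoc b a (x j)))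
                       (trans (*-congʳ ba≈1) (*-identityˡ (x j)))) (span-* b sp)

  span-linComb : ∀ {l m n} {u : Family l n} {w : Family m n} → (∀ i → Span u (w i)) → ∀ c → Span u (linComb c w)
  span-linComb {u = u} {w} w⊆u c = span (linComb c (λ i → coeffs (w⊆u i))) λ j →
    trans (linComb-congʳ c (λ i → expands (w⊆u i)) j) (linComb-linComb c (λ i → coeffs (w⊆u i)) u j)

  span-trans : ∀ {l m n} {u : Family l n} {w : Family m n} → (∀ i → Span u (w i)) → ∀ {x} → Span w x → Span u x
  span-trans w⊆u (span c x≋) = span-resp (λ j → sym (x≋ j)) (span-linComb w⊆u c)

  span-++ˡ : ∀ {m m′ n} {u : Family m n} {w : Family m′ n} {x} → Span u x → Span (u ++ w) x
  span-++ˡ {u = u} {w} = span-trans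
    (λ i → span-resp (λ j → reflexive (≡.cong-app (lookup-++ˡ u w i) j)) (span-∈ _))

  span-++ʳ : ∀ {m m′ n} {u : Family m n} {w : Family m′ n} {x} → Span w x → Span (u ++ w) x
  span-++ʳ {u = u} {w} = span-trans
    (λ i → span-resp (λ j → reflexive (≡.cong-app (lookup-++ʳ u w i) j)) (span-∈ _))

  span-there : ∀ {m n} {w : Family m n} {y x} → Span w x → Span (y ∷ w) x
  span-there = span-trans (λ i → span-∈ (suc i))

  span-standard : ∀ {m n} {w : Family m n} → (∀ i → Span w (δ i)) → ∀ x → Span w x
  span-standard {w = w} e⊆w x = span-resp
    (λ j → trans (∑-cong (λ i → trans (*-comm (x i) (δ i j)) (*-congʳ (δ-sym i j)))) (∑-δ j x))
    (span-linComb e⊆w x)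

  -- One step of Gaussian elimination: column j is cleared using the pivot x j and then deleted.
  module Elimination {m n : ℕ} (x : Fin (suc n) → Carrier) (w : Family m (suc n)) (j : Fin (suc n))
    (xj≉0 : ¬ x j ≈ 0#) where
    x⁻¹ = proj₁ (inverse xj≉0)

    q : Fin m → Carrier
    q i = w i j * x⁻¹

    w° : Family m (suc n)
    w° i k = w i k + - q i * x k

    reduced : Family m n
    reduced i k = w° i (punchIn j k)

    column-cleared : ∀ i → w° i j ≈ 0#
    column-cleared i = trans (+-congˡ (begin
      - q i * x j                ≈⟨ -‿distribˡ-* (q i) (x j) ⟨
      - (w i j * x⁻¹ * x j)      ≈⟨ -‿cong (*-assoc (w i j) x⁻¹ (x j)) ⟩
      - (w i j * (x⁻¹ * x j))    ≈⟨ -‿cong (*-congˡ (proj₂ (inverse xj≉0))) ⟩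
      - (w i j * 1#)             ≈⟨ -‿cong (*-identityʳ (w i j)) ⟩
      - w i j                    ∎)) (-‿inverseʳ (w i j))

    linComb-w° : ∀ c k → linComb c w° k ≈ - ∑ (λ i → c i * q i) * x k + linComb c w k
    linComb-w° c k = begin
      ∑ (λ i → c i * (w i k + - q i * x k))              ≈⟨ ∑-cong (λ i → distribˡ (c i) _ _) ⟩
      ∑ (λ i → c i * w i k + c i * (- q i * x k))        ≈⟨ ∑-+ (λ i → c i * w i k)
        (λ i → c i * (- q i * x k)) ⟩
      linComb c w k + ∑ (λ i → c i * (- q i * x k))      ≈⟨ +-comm _ _ ⟩
      ∑ (λ i → c i * (- q i * x k)) + linComb c w k      ≈⟨ +-congʳ (∑-cong term) ⟩
      ∑ (λ i → c i * q i * - x k) + linComb c w k        ≈⟨ +-congʳ (∑-*ʳ (- x k) (λ i → c i * q i)) ⟩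
      ∑ (λ i → c i * q i) * - x k + linComb c w k        ≈⟨ +-congʳ (move _ (x k)) ⟩
      - ∑ (λ i → c i * q i) * x k + linComb c w k        ∎
      where
      move : ∀ a b → a * - b ≈ - a * b
      move a b = trans (sym (-‿distribʳ-* a b)) (-‿distribˡ-* a b)
      term : ∀ i → c i * (- q i * x k) ≈ c i * q i * - x k
      term i = trans (*-congˡ (sym (move (q i) (x k)))) (sym (*-assoc (c i) (q i) (- x k)))

    w°-zero : ∀ c → IsZeroVec (linComb c reduced) → IsZeroVec (linComb c w°)
    w°-zero c z k with j ≟ᶠ k
    ... | yes ≡.refl = ∑-zero (λ i → trans (*-congˡ (column-cleared i)) (zeroʳ (c i)))
    ... | no  j≢k    = ≡.subst (λ l → linComb c w° l ≈ 0#) (punchIn-punchOut j≢k) (z (punchOut j≢k))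

    dependent : Dependent reduced → Dependent (x ∷ w)
    dependent (c , z , i , ci≉0) = (- ∑ (λ i → c i * q i) ∷ c) ,
      (λ k → trans (sym (linComb-w° c k)) (w°-zero c z k)) , suc i , ci≉0

    -- A relation among `x ∷ w` makes a combination of the cleared vectors a multiple of `x`. Column
    -- `j` is zero on the cleared side and nonzero in `x`, so the multiple is zero.
    independent : Independent reduced → Independent (x ∷ w)
    independent ind c z = λ { zero → c₀≈0 ; (suc i) → c′≈0 i }
      where
      c′ = c ∘ suc
      s  = ∑ (λ i → c′ i * q i)

      w°≈ : ∀ k → linComb c′ w° k ≈ - (s + c zero) * x k
      w°≈ k = begin
        linComb c′ w° k                             ≈⟨ linComb-w° c′ k ⟩
        - s * x k + linComb c′ w k                  ≈⟨ +-congˡ (+-inverseʳ-unique _ _ (z k)) ⟩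
        - s * x k + - (c zero * x k)                ≈⟨ +-congˡ (-‿distribˡ-* (c zero) (x k)) ⟩
        - s * x k + - c zero * x k                  ≈⟨ distribʳ (x k) (- s) (- c zero) ⟨
        (- s + - c zero) * x k                      ≈⟨ *-congʳ (⁻¹-∙-comm s (c zero)) ⟩
        - (s + c zero) * x k                        ∎
        where open import Algebra.Properties.AbelianGroup +-abelianGroup using (⁻¹-∙-comm)

      coef≈0 : - (s + c zero) ≈ 0#
      coef≈0 = cancel-unit xj≉0 (trans (*-comm (x j) _) (trans (sym (w°≈ j))
        (∑-zero (λ i → trans (*-congˡ (column-cleared i)) (zeroʳ (c′ i))))))

      c′≈0 : ∀ i → c′ i ≈ 0#
      c′≈0 = ind c′ (λ k → trans (w°≈ (punchIn j k)) (trans (*-congʳ coef≈0) (zeroˡ _)))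

      c₀≈0 : c zero ≈ 0#
      c₀≈0 = cancel-unit xj≉0 (trans (*-comm (x j) _) (trans (sym (+-identityʳ _))
        (trans (+-congˡ (sym (linComb-zero w c′≈0 j))) (z j))))

  -- Elimination with the first vector as pivot row. Each pivot uses up one coordinate, which is why
  -- the bound `m ≤ n` comes out together with independence; the exchange lemma and all dimension
  -- counts rest on it.
  dichotomy : ∀ {m n} (w : Family m n) → (Independent w × m ℕ.≤ n) ⊎ Dependent w
  dichotomy {zero} w = inj₁ ((λ c z ()) , z≤n)
  dichotomy {suc m} {n} w with any? (λ j → ¬? (w zero j ≈? 0#))
  -- A zero first vector is dependent by itself; this case also covers vectors with no coordinates.
  ... | no none = inj₂ ((1# ∷ λ _ → 0#) , (λ j → trans
          (+-cong (trans (*-identityˡ _) (decidable-stable (w zero j ≈? 0#) (λ h → none (j , h))))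
                  (linComb-zero (w ∘ suc) (λ _ → refl) j)) (+-identityˡ 0#)) , zero , 1≉0)
  dichotomy {suc m} {suc n} w | yes (j , wj≉0) with dichotomy (Elimination.reduced (w zero) (w ∘ suc) j wj≉0)
  ... | inj₁ (ind , m≤n) = inj₁ ((λ c z → Elimination.independent (w zero) (w ∘ suc) j wj≉0 ind c z) , s≤s m≤n)
  ... | inj₂ dep with Elimination.dependent (w zero) (w ∘ suc) j wj≉0 dep
  ...   | c , z , i , ci≉0 = inj₂ (c , z , i , ci≉0)

  dependent⇒¬independent : ∀ {m n} {w : Family m n} → Dependent w → ¬ Independent w
  dependent⇒¬independent (c , z , i , ci≉0) ind = ci≉0 (ind c z i)

  independent⇒≤ : ∀ {m n} {w : Family m n} → Independent w → m ℕ.≤ n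
  independent⇒≤ {w = w} ind with dichotomy w
  ... | inj₁ (_ , m≤n) = m≤n
  ... | inj₂ dep       = ⊥-elim (dependent⇒¬independent dep ind)

  -- A relation among the coefficient vectors of the `u i` is a relation among the `u i`, so these
  -- `l` vectors of length `m` are independent.
  steinitz : ∀ {l m n} {u : Family l n} {w : Family m n} →
             Independent u → (∀ i → Span w (u i)) → l ℕ.≤ m
  steinitz {u = u} {w} ind u⊆w = independent⇒≤ {w = λ i → coeffs (u⊆w i)} λ c z → ind c λ j → begin
    linComb c u j                                       ≈⟨ linComb-congʳ c (λ i → expands (u⊆w i)) j ⟩
    linComb c (λ i → linComb (coeffs (u⊆w i)) w) j       ≈⟨ linComb-linComb c (λ i → coeffs (u⊆w i)) w j ⟩
    linComb (linComb c (λ i → coeffs (u⊆w i))) w j       ≈⟨ linComb-zero w z j ⟩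
    0#                                                  ∎

  size-unique : ∀ {l m n} {u : Family l n} {w : Family m n} → Independent u → Independent w →
                (∀ i → Span w (u i)) → (∀ i → Span u (w i)) → l ≡ m
  size-unique indu indw u⊆w w⊆u = ℕₚ.≤-antisym (steinitz indu u⊆w) (steinitz indw w⊆u)

  -- The relation must involve `x`, or it would be a nontrivial relation within `w`.
  dependent-∷ : ∀ {m n} {x} {w : Family m n} → Independent w → Dependent (x ∷ w) → Span w x
  dependent-∷ {x = x} {w} ind (c , z , i , ci≉0) = solve (c zero ≈? 0#)
    where
    solve : Dec (c zero ≈ 0#) → Span w x
    solve (yes c₀≈0) = ⊥-elim (ci≉0 (all i))
      where
      all : ∀ i → c i ≈ 0#
      all zero = c₀≈0
      all (suc i) = ind (c ∘ suc) (λ j → trans (sym (+-identityˡ _))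
        (trans (+-congʳ (sym (trans (*-congʳ c₀≈0) (zeroˡ (x j))))) (z j))) i
    solve (no c₀≉0) = span-unscale c₀≉0 (span (λ i → - 1# * c (suc i)) λ j → begin
      c zero * x j                          ≈⟨ +-inverseˡ-unique _ _ (z j) ⟩
      - linComb (c ∘ suc) w j               ≈⟨ -‿cong (*-identityˡ _) ⟨
      - (1# * linComb (c ∘ suc) w j)        ≈⟨ -‿distribˡ-* _ _ ⟩
      - 1# * linComb (c ∘ suc) w j          ≈⟨ linComb-*ˡ (- 1#) (c ∘ suc) w j ⟨
      linComb (λ i → - 1# * c (suc i)) w j  ∎)

  span⊎independent : ∀ {m n} x {w : Family m n} → Independent w → Span w x ⊎ Independent (x ∷ w)
  span⊎independent x {w} ind with dichotomy (x ∷ w)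
  ... | inj₁ (ind′ , _) = inj₂ ind′
  ... | inj₂ dep        = inj₁ (dependent-∷ ind dep)

  independent⇒spanning : ∀ {m n} {w : Family m n} → m ≡ n → Independent w → ∀ x → Span w x
  independent⇒spanning m≡n ind x with span⊎independent x ind
  ... | inj₁ sp   = sp
  ... | inj₂ ind′ = ⊥-elim (ℕₚ.<-irrefl m≡n (independent⇒≤ {w = x ∷ _} ind′))

  -- Maximality in `HasDim` is a negative statement; deciding between `span⊎independent` turns it
  -- into an actual expansion.
  hasDim-spanning : ∀ {n d} {S : (Fin n → Carrier) → Set} (h : HasDim S d) →
                    ∀ {x} → S x → Span (proj₁ (proj₁ h)) x
  hasDim-spanning {d = d} {S} ((w , w∈S , ind) , max) {x} x∈S with span⊎independent x ind
  ... | inj₁ sp   = sp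
  ... | inj₂ ind′ = ⊥-elim (max (x ∷ w) (λ { zero → x∈S ; (suc i) → w∈S i }) ind′)

  independent-++ : ∀ {m m′ n} {u : Family m n} {w : Family m′ n} → Independent (u ++ w) → ∀ c d →
                   (∀ j → linComb c u j + linComb d w j ≈ 0#) → (∀ i → c i ≈ 0#) × (∀ i → d i ≈ 0#)
  independent-++ {u = u} {w} ind c d z =
    (λ i → trans (reflexive (≡.sym (lookup-++ˡ c d i))) (cd≈0 (i ↑ˡ _))) ,
    (λ i → trans (reflexive (≡.sym (lookup-++ʳ c d i))) (cd≈0 (_ ↑ʳ i)))
    where
    cd≈0 : ∀ i → (c ++ d) i ≈ 0#
    cd≈0 = ind (c ++ d) (λ j → trans (linComb-++-++ c d u w j) (z j))

  -- The vectors `u` are independent modulo the span of `w`. With `w` the reduction of a smaller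
  -- lattice T⁻¹(p^i ℤ^v), this is how coefficients are shown to be divisible by p.
  independent-++-span : ∀ {m m′ n} {u : Family m n} {w : Family m′ n} → Independent (u ++ w) →
                        ∀ c → Span w (linComb c u) → ∀ i → c i ≈ 0#
  independent-++-span {u = u} {w} ind c (span d cu≋) = proj₁
    (independent-++ {u = u} {w} ind c (λ i → - 1# * d i) λ j → begin
    linComb c u j + linComb (λ i → - 1# * d i) w j   ≈⟨ +-cong (cu≋ j) (linComb-*ˡ (- 1#) d w j) ⟩
    linComb d w j + - 1# * linComb d w j             ≈⟨ +-congˡ (-‿distribˡ-* 1# _) ⟨
    linComb d w j + - (1# * linComb d w j)           ≈⟨ +-congˡ (-‿cong (*-identityˡ _)) ⟩
    linComb d w j + - linComb d w j                  ≈⟨ -‿inverseʳ _ ⟩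
    0#                                               ∎)

  ++-independent : ∀ {m m′ n} {u : Family m n} {w : Family m′ n} →
                   (∀ c d → (∀ j → linComb c u j + linComb d w j ≈ 0#) → (∀ i → c i ≈ 0#) × (∀ i → d i ≈ 0#)) →
                   Independent (u ++ w)
  ++-independent {m} {m′} {u = u} {w} h c z i =
    ≡.subst (λ k → c k ≈ 0#) (join-splitAt m m′ i) (at (splitAt m i))
    where
    both = h (λ i → c (i ↑ˡ m′)) (λ i → c (m ↑ʳ i)) (λ j → trans (sym (linComb-++ c u w j)) (z j))
    at : ∀ k → c (join m m′ k) ≈ 0#
    at (inj₁ k) = proj₁ both k
    at (inj₂ k) = proj₂ both k

  δ-independent : ∀ {n} → Independent {n} {n} δ
  δ-independent c z i = trans (sym (∑-δ i c))
    (trans (∑-cong (λ j → trans (*-comm (δ i j) (c j)) (*-congˡ (δ-sym i j)))) (z i))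

  basis-size : ∀ {m n} {w : Family m n} → Independent w → (∀ x → Span w x) → m ≡ n
  basis-size {w = w} ind sp = ℕₚ.≤-antisym (independent⇒≤ {w = w} ind) (steinitz δ-independent (λ i → sp (δ i)))

  -- The vectors added to u are members of w, hence inherit any property P of the members of w.
  record Extension {m l n} (P : (Fin n → Carrier) → Set) (u : Family m n) (w : Family l n) : Set where
    field
      size  : ℕ
      new   : Family size n
      new∈P : ∀ i → P (new i)
      indep : Independent (new ++ u)
      spans : ∀ i → Span (new ++ u) (w i)

  extend : ∀ {m l n} (P : (Fin n → Carrier) → Set) {u : Family m n} (w : Family l n) →
           Independent u → (∀ i → P (w i)) → Extension P u w
  extend {l = zero} P w ind w∈P = record
    { size = 0 ; new = λ () ; new∈P = λ () ; indep = ind ; spans = λ () }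
  extend {m} {suc l} {n} P {u} w ind w∈P with extend P (w ∘ suc) ind (w∈P ∘ suc)
  ... | E with span⊎independent (w zero) (Extension.indep E)
  ...   | inj₁ sp = record
    { Extension E
    ; spans = λ { zero → sp ; (suc i) → Extension.spans E i } }
  ...   | inj₂ ind′ = record
    { size = suc size
    ; new = w zero ∷ new
    ; new∈P = λ { zero → w∈P zero ; (suc i) → new∈P i }
    ; indep = λ c z i → ind′ c
      (λ j → trans (linComb-congʳ c (λ i j → reflexive (≡.cong-app (same i) j)) j) (z j)) i
    ; spans = λ i → span-trans {w = w zero ∷ (new ++ u)}
      (λ k → span-resp (λ j → reflexive (≡.cong-app (≡.sym (same k)) j)) (span-∈ k)) (sp′ i)
    }
    where
    open Extension E
    -- The two bracketings agree only after `splitAt` has been evaluated at the index.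
    same : ∀ i → (w zero ∷ (new ++ u)) i ≡ ((w zero ∷ new) ++ u) i
    same zero = ≡.refl
    same (suc i) with splitAt size i
    ... | inj₁ _ = ≡.refl
    ... | inj₂ _ = ≡.refl
    sp′ : ∀ i → Span (w zero ∷ (new ++ u)) (w i)
    sp′ zero = span-∈ zero
    sp′ (suc i) = span-there (spans i)

-- Congruences of integers and the field with p elements.

module Congruence where
  open import Data.Integer using (-_; ∣_∣; _+_; _*_; _-_)
  open ≡ using (refl; sym; trans; cong; subst)

  infix 4 _≈_[mod_]

  -- A record rather than the divisibility statement itself, so that a and b can be inferred.
  record _≈_[mod_] (a b P : ℤ) : Set where
    constructor mod
    field
      quot : ℤ
      eq   : a ≡ b + P * quot
  open _≈_[mod_] public

  module _ {P : ℤ} where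

    ≡⇒≈ : ∀ {a b} → a ≡ b → a ≈ b [mod P ]
    ≡⇒≈ {a} refl = mod (+ 0) (lem a P)
      where
      lem : ∀ a P → a ≡ a + P * + 0
      lem = solve-∀

    ≈-sym : ∀ {a b} → a ≈ b [mod P ] → b ≈ a [mod P ]
    ≈-sym {b = b} (mod q refl) = mod (- q) (lem b P q)
      where
      lem : ∀ b P q → b ≡ b + P * q + P * (- q)
      lem = solve-∀

    ≈-trans : ∀ {a b c} → a ≈ b [mod P ] → b ≈ c [mod P ] → a ≈ c [mod P ]
    ≈-trans {c = c} (mod q refl) (mod q′ refl) = mod (q′ + q) (lem c P q q′)
      where
      lem : ∀ c P q q′ → c + P * q′ + P * q ≡ c + P * (q′ + q)
      lem = solve-∀

    ≈-+ : ∀ {a b c d} → a ≈ b [mod P ] → c ≈ d [mod P ] → (a + c) ≈ (b + d) [mod P ]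
    ≈-+ {b = b} {d = d} (mod q refl) (mod q′ refl) = mod (q + q′) (lem b d P q q′)
      where
      lem : ∀ b d P q q′ → b + P * q + (d + P * q′) ≡ b + d + P * (q + q′)
      lem = solve-∀

    ≈-* : ∀ {a b c d} → a ≈ b [mod P ] → c ≈ d [mod P ] → (a * c) ≈ (b * d) [mod P ]
    ≈-* {b = b} {d = d} (mod q refl) (mod q′ refl) = mod (q * d + b * q′ + P * (q * q′)) (lem b d P q q′)
      where
      lem : ∀ b d P q q′ → (b + P * q) * (d + P * q′) ≡ b * d + P * (q * d + b * q′ + P * (q * q′))
      lem = solve-∀

    ≈-neg : ∀ {a b} → a ≈ b [mod P ] → (- a) ≈ (- b) [mod P ]
    ≈-neg {b = b} (mod q refl) = mod (- q) (lem b P q)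
      where
      lem : ∀ b P q → - (b + P * q) ≡ - b + P * (- q)
      lem = solve-∀

    ≈⇒∣ : ∀ {a b} → a ≈ b [mod P ] → P ℤD.∣ (a - b)
    ≈⇒∣ {b = b} (mod q refl) = ℤS.∣⇒∣ᵤ (ℤS.divides q (lem b P q))
      where
      lem : ∀ b P q → b + P * q - b ≡ q * P
      lem = solve-∀

    ∣⇒≈ : ∀ {a b} → P ℤD.∣ (a - b) → a ≈ b [mod P ]
    ∣⇒≈ {a} {b} d with ℤS.∣ᵤ⇒∣ d
    ... | ℤS.divides q e = mod q (trans (lem a b) (trans (cong (λ x → b + x) e) (lem′ b P q)))
      where
      lem : ∀ a b → a ≡ b + (a - b)
      lem = solve-∀
      lem′ : ∀ b P q → b + q * P ≡ b + P * q
      lem′ = solve-∀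

    ∣⇒≈0 : ∀ {a} → P ℤD.∣ a → a ≈ + 0 [mod P ]
    ∣⇒≈0 {a} d = ∣⇒≈ (subst (P ℤD.∣_) (sym (ℤₚ.+-identityʳ a)) d)

    ≈0⇒∣ : ∀ {a} → a ≈ + 0 [mod P ] → P ℤD.∣ a
    ≈0⇒∣ {a} m = subst (P ℤD.∣_) (ℤₚ.+-identityʳ a) (≈⇒∣ m)

    multiple : ∀ {a} → (m : a ≈ + 0 [mod P ]) → a ≡ P * quot m
    multiple (mod q e) = trans e (ℤₚ.+-identityˡ _)

    P*≈0 : ∀ q → (P * q) ≈ + 0 [mod P ]
    P*≈0 q = mod q (sym (ℤₚ.+-identityˡ _))

  ℤ/_ : ℤ → CommutativeRing _ _
  ℤ/ P = record
    { Carrier = ℤ ; _≈_ = λ a b → a ≈ b [mod P ] ; _+_ = _+_ ; _*_ = _*_ ; -_ = -_ ; 0# = + 0 ; 1# = + 1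
    ; isCommutativeRing = record
      { isRing = record
        { +-isAbelianGroup = record
          { isGroup = record
            { isMonoid = record
              { isSemigroup = record
                { isMagma = record
                  { isEquivalence = record { refl = ≡⇒≈ refl ; sym = ≈-sym ; trans = ≈-trans }
                  ; ∙-cong = ≈-+ }
                ; assoc = λ x y z → ≡⇒≈ (ℤₚ.+-assoc x y z) }
              ; identity = (λ x → ≡⇒≈ (ℤₚ.+-identityˡ x)) , (λ x → ≡⇒≈ (ℤₚ.+-identityʳ x)) }
            ; inverse = (λ x → ≡⇒≈ (ℤₚ.+-inverseˡ x)) , (λ x → ≡⇒≈ (ℤₚ.+-inverseʳ x))
            ; ⁻¹-cong = ≈-neg }
          ; comm = λ x y → ≡⇒≈ (ℤₚ.+-comm x y) }
        ; *-cong = ≈-*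
        ; *-assoc = λ x y z → ≡⇒≈ (ℤₚ.*-assoc x y z)
        ; *-identity = (λ x → ≡⇒≈ (ℤₚ.*-identityˡ x)) , (λ x → ≡⇒≈ (ℤₚ.*-identityʳ x))
        ; distrib = (λ x y z → ≡⇒≈ (ℤₚ.*-distribˡ-+ x y z)) , (λ x y z → ≡⇒≈ (ℤₚ.*-distribʳ-+ x y z))
        }
      ; *-comm = λ x y → ≡⇒≈ (ℤₚ.*-comm x y)
      }
    }

  module _ {p : ℕ} (pp : Prime p) where

    -- Bézout for the coprime numbers p and |a|, with the sign of `a` restored afterwards.
    inverse-mod : ∀ {a} → ¬ a ≈ + 0 [mod + p ] → Σ ℤ λ b → (b * a) ≈ + 1 [mod + p ]
    inverse-mod {a} a≉0 = signed (ℤₚ.+∣i∣≡i⊎+∣i∣≡-i a) abs-inverse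
      where
      coprime : Coprime p ∣ a ∣
      coprime (d∣p , d∣a) with prime⇒irreducible pp d∣p
      ... | inj₁ d≡1  = d≡1
      ... | inj₂ refl = ⊥-elim (a≉0 (∣⇒≈0 d∣a))

      cast : ∀ x y z → 1 ℕ.+ x ℕ.* y ≡ z → + 1 + + x * + y ≡ + z
      cast x y z e = trans (cong (λ x → + 1 + x) (sym (ℤₚ.pos-* x y))) (cong +_ e)

      abs-inverse : Σ ℤ λ b → (b * + ∣ a ∣) ≈ + 1 [mod + p ]
      abs-inverse with coprime-Bézout coprime
      ... | Bézout.+- x y e = - + y , mod (- + x) (trans (lem (+ y) (+ ∣ a ∣))
              (trans (cong (λ z → + 1 - z) (trans (cast y ∣ a ∣ _ e) (ℤₚ.pos-* x p))) (lem′ (+ x) (+ p))))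
        where
        lem : ∀ y n → (- y) * n ≡ + 1 - (+ 1 + y * n)
        lem = solve-∀
        lem′ : ∀ x p → + 1 - x * p ≡ + 1 + p * (- x)
        lem′ = solve-∀
      ... | Bézout.-+ x y e = + y , mod (+ x) (trans (sym (ℤₚ.pos-* y ∣ a ∣))
              (trans (sym (cast x p _ e)) (cong (λ x → + 1 + x) (ℤₚ.*-comm (+ x) (+ p)))))

      signed : + ∣ a ∣ ≡ a ⊎ + ∣ a ∣ ≡ - a → (Σ ℤ λ b → (b * + ∣ a ∣) ≈ + 1 [mod + p ]) →
               Σ ℤ λ b → (b * a) ≈ + 1 [mod + p ]
      signed (inj₁ e) (b , m) = b , subst (λ x → (b * x) ≈ + 1 [mod + p ]) e m
      signed (inj₂ e) (b , m) = - b , ≈-trans (≡⇒≈ (trans (lem b a) (cong (b *_) (sym e)))) m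
        where
        lem : ∀ b a → (- b) * a ≡ b * (- a)
        lem = solve-∀

    𝔽 : DiscreteField
    𝔽 = record
      { commutativeRing = ℤ/ (+ p)
      ; _≈?_ = λ a b → map′ ∣⇒≈ ≈⇒∣ (p ℕD.∣? ∣ a - b ∣)
      ; inverse = inverse-mod
      ; 1≉0 = λ 1≈0 → ¬prime[1] (subst Prime (ℕD.∣1⇒≡1 (≈0⇒∣ 1≈0)) pp)
      }

    private module LA = LinearAlgebra 𝔽

    -- The two presentations of the field differ only in how congruence is encoded. `Independent`
    -- has congruences on both sides of an implication, so each translation uses both directions of
    -- the equivalence.
    rank-𝔽 : ∀ {m n} {M : Fin m → Fin n → ℤ} {e} → LinFp.Rank p M e → LA.Rank M e
    rank-𝔽 {m} {M = M} ((w , w∈ , ind) , max) =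
      (w , (λ i → proj₁ (w∈ i) , λ j → ∣⇒≈ (proj₂ (w∈ i) j)) , to w ind) ,
      λ u u∈ indu → max u (λ i → proj₁ (u∈ i) , λ j → ≈⇒∣ (proj₂ (u∈ i) j)) (from u indu)
      where
      to : ∀ {l} (u : Fin l → Fin m → ℤ) → LinFp.Independent p u → LA.Independent u
      to u h c z i = ∣⇒≈ (h c (λ j → ≈⇒∣ (z j)) i)
      from : ∀ {l} (u : Fin l → Fin m → ℤ) → LA.Independent u → LinFp.Independent p u
      from u h c z i = ≈⇒∣ (h c (λ j → ∣⇒≈ (z j)) i)

open Congruence

-- The filtration of 𝔽_p^v defined by the powers of p dividing T x.

module IntegralLattice where
  open import Data.Integer using (-_; _+_; _*_; _-_)
  open ≡ using (refl; sym; trans; cong; cong₂; subst)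

  ++-all : ∀ {A : Set} {Q : A → Set} {m n} {u : Fin m → A} {w : Fin n → A} →
           (∀ i → Q (u i)) → (∀ i → Q (w i)) → ∀ i → Q ((u ++ w) i)
  ++-all {m = m} Qu Qw i with splitAt m i
  ... | inj₁ j = Qu j
  ... | inj₂ j = Qw j

  module ℤV = Sums ℤₚ.+-*-commutativeRing
  open ℤV using (∑; δ; linComb)

  ∑-δ-row : ∀ {n} (i : Fin n) → ∑ (δ i) ≡ + 1
  ∑-δ-row i = trans (sym (ℤV.∑-cong (λ j → ℤₚ.*-identityʳ (δ i j)))) (ℤV.∑-δ i (λ _ → + 1))

  ∑-ones : ∀ n → ∑ {n} (λ _ → + 1) ≡ + n
  ∑-ones zero = refl
  ∑-ones (suc n) = cong (λ x → + 1 + x) (∑-ones n)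

  -- The Laplacian enters only through quadratic (with P τ = r + s and P² u = r s), ∑T and T𝟙.
  module Core
    {n : ℕ} (L : Fin (suc n) → Fin (suc n) → ℤ) {p : ℕ} (pp : Prime p) (τ u μ : ℤ)
    (u≉0 : ¬ u ≈ + 0 [mod + p ])
    (quadratic : ∀ x i → LinZ.mulMV L (LinZ.mulMV L x) i ≡ + p * τ * LinZ.mulMV L x i - + p *
      (+ p * u) * x i + μ * ∑ x)
    (∑T : ∀ x → ∑ (LinZ.mulMV L x) ≡ + 0)
    (T𝟙 : ∀ i → LinZ.mulMV L (λ _ → + 1) i ≡ + 0)
    where

    v = suc n
    P = + p

    open LinearAlgebra (𝔽 pp)
      using (Family; Independent; Rank; Span; span; coeffs; expands; Extension; extend; cancel-unit;
             span-resp; span-+; span-*; span-∈; span-unscale; span-trans; span-++ˡ; span-++ʳ; span-there;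
             span-standard; basis-size; size-unique; span⊎independent; independent⇒spanning;
             hasDim-spanning; independent-++-span; ++-independent)
    module 𝔽V = LinearAlgebra (𝔽 pp)
    open import Relation.Binary.Reasoning.Setoid (CommutativeRing.setoid (ℤ/ P))

    instance
      P-nonZero : ℤ.NonZero P
      P-nonZero = prime⇒nonZero pp

    infix 4 _≈_
    _≈_ : ℤ → ℤ → Set
    a ≈ b = a ≈ b [mod P ]

    ≈-refl : ∀ {a} → a ≈ a
    ≈-refl = ≡⇒≈ refl

    P-cancel : ∀ {x y} → P * x ≡ P * y → x ≡ y
    P-cancel {x} {y} = ℤₚ.*-cancelˡ-≡ P x y

    T : ZVec v → ZVec v
    T = LinZ.mulMV L

    𝟙 : ZVec v
    𝟙 _ = + 1

    T-cong : ∀ {x y} → (∀ j → x j ≡ y j) → ∀ i → T x i ≡ T y i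
    T-cong = ℤV.mulMV-cong L

    T-cong-≈ : ∀ {x y} → (∀ j → x j ≈ y j) → ∀ i → T x i ≈ T y i
    T-cong-≈ = 𝔽V.mulMV-cong L

    T-+ : ∀ x y i → T (λ j → x j + y j) i ≡ T x i + T y i
    T-+ = ℤV.mulMV-+ L

    T-* : ∀ a x i → T (λ j → a * x j) i ≡ a * T x i
    T-* = ℤV.mulMV-* L

    T-linComb : ∀ {m} c (w : Fin m → ZVec v) i → T (linComb c w) i ≡ linComb c (λ k → T (w k)) i
    T-linComb = ℤV.mulMV-linComb L

    T-zero : ∀ {x} → (∀ j → x j ≈ + 0) → ∀ i → T x i ≈ + 0
    T-zero x≈0 i = ≈-trans (T-cong-≈ x≈0 i) (≡⇒≈ (ℤV.∑-zero (λ j → ℤₚ.*-zeroʳ (L i j))))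

    -- The reduction mod p of the lattice of sum-zero vectors is spanned by the d i, and
    -- T (T (d i) - P τ (d i)) = - P² u (d i), so s consists of vectors sent by T into P².
    d : Fin n → ZVec v
    d i j = δ (suc i) j + - + 1 * δ zero j

    s : Fin n → ZVec v
    s i j = T (d i) j + - (P * τ) * d i j

    ∑d : ∀ i → ∑ (d i) ≡ + 0
    ∑d i = trans (ℤV.∑-+ (δ (suc i)) (λ j → - + 1 * δ zero j))
      (cong₂ _+_ {∑ (δ (suc i))} {+ 1} {v = - + 1} (∑-δ-row (suc i))
        (trans (ℤV.∑-*ˡ {v} (- + 1) (δ zero)) (cong (- + 1 *_) {∑ (δ {v} zero)} (∑-δ-row {v} zero))))

    T-s : ∀ i j → T (s i) j ≡ P * (P * (- u * d i j))
    T-s i j = trans (T-+ (T (d i)) (λ j → - (P * τ) * d i j) j)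
      (trans (cong₂ _+_ (trans (quadratic (d i) j)
        (cong (λ x → P * τ * T (d i) j - P * (P * u) * d i j + μ * x) (∑d i)))
                        (T-* (- (P * τ)) (d i) j))
             (lem P τ u (T (d i) j) (d i j) μ))
      where
      lem : ∀ P τ u t x μ → P * τ * t - P * (P * u) * x + μ * + 0 + - (P * τ) * t ≡ P * (P * (- u * x))
      lem = solve-∀

    s≈Td : ∀ i j → s i j ≈ T (d i) j
    s≈Td i j = mod (- τ * d i j) (lem P τ (T (d i) j) (d i j))
      where
      lem : ∀ P τ t x → t + - (P * τ) * x ≡ t + P * (- τ * x)
      lem = solve-∀

    sumZero-expand : ∀ y → ∑ y ≈ + 0 → ∀ j → y j ≈ linComb (y ∘ suc) d j
    sumZero-expand y ∑y≈0 zero = begin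
      y zero                                       ≡⟨ lem (y zero) (∑ (y ∘ suc)) ⟩
      ∑ y + - + 1 * ∑ (y ∘ suc)                    ≈⟨ ≈-+ ∑y≈0 ≈-refl ⟩
      + 0 + - + 1 * ∑ (y ∘ suc)                    ≡⟨ ℤₚ.+-identityˡ _ ⟩
      - + 1 * ∑ (y ∘ suc)                          ≡⟨ ℤV.∑-*ˡ (- + 1) (y ∘ suc) ⟨
      ∑ (λ i → - + 1 * y (suc i))                  ≡⟨ ℤV.∑-cong (λ i → ℤₚ.*-comm (- + 1) (y (suc i))) ⟩
      linComb (y ∘ suc) d zero                     ∎
      where
      lem : ∀ a b → a ≡ a + b + - + 1 * b
      lem = solve-∀
    sumZero-expand y ∑y≈0 (suc j) = begin
      y (suc j)                                    ≡⟨ ℤV.∑-δ j (y ∘ suc) ⟨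
      ∑ (λ i → δ j i * y (suc i))                  ≡⟨ ℤV.∑-cong
        (λ i → trans (cong (_* y (suc i)) (ℤV.δ-sym j i)) (lem (δ i j) (y (suc i)))) ⟩
      linComb (y ∘ suc) d (suc j)                  ∎
      where
      lem : ∀ a b → a * b ≡ b * (a + - + 1 * + 0)
      lem = solve-∀

    T-sumZero : ∀ y → ∑ y ≈ + 0 → Span s (T y)
    T-sumZero y ∑y≈0 = span (y ∘ suc) λ j → begin
      T y j                                ≈⟨ T-cong-≈ (sumZero-expand y ∑y≈0) j ⟩
      T (linComb (y ∘ suc) d) j            ≡⟨ T-linComb (y ∘ suc) d j ⟩
      linComb (y ∘ suc) (λ i → T (d i)) j  ≈⟨ 𝔽V.linComb-congʳ (y ∘ suc) s≈Td j ⟨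
      linComb (y ∘ suc) s j                ∎

    -- A combination of the `d i` has sum exactly zero and not merely zero mod p, so the quadratic
    -- relation applies to this preimage without its `μ`-term.
    span-s⇒T : ∀ {x} → Span s x → Σ (ZVec v) λ y → (∑ y ≡ + 0) × (∀ j → x j ≈ T y j)
    span-s⇒T {x} (span c x≈) = linComb c d ,
      trans (ℤV.∑-linComb c d) (ℤV.∑-zero (λ i → trans (cong (c i *_) (∑d i)) (ℤₚ.*-zeroʳ (c i)))) ,
      λ j → begin
        x j                        ≈⟨ x≈ j ⟩
        linComb c s j              ≈⟨ 𝔽V.linComb-congʳ c s≈Td j ⟩
        linComb c (λ i → T (d i)) j ≡⟨ T-linComb c d j ⟨
        T (linComb c d) j          ∎

    -- Sums of image vectors vanish, hence `∑ y` does. Applying `T` once more and comparing with the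
    -- quadratic relation gives p² `D j` = μ ∑ x, which does not depend on `j`; so `D` is a constant
    -- vector, with value `D zero`.
    preimage-P² : ∀ x y → (∀ j → T x j ≡ P * (P * y j)) →
                  (∑ y ≡ + 0) × Σ ℤ λ c → ∀ j → u * x j ≡ P * τ * y j - T y j + c
    preimage-P² x y Tx≡ = P-cancel (P-cancel ∑PPy) , D zero , λ j →
      trans (lem₁ (u * x j) (P * τ * y j) (T y j))
        (cong (λ z → P * τ * y j - T y j + z) (P-cancel (P-cancel (trans (PPD j) (sym (PPD zero))))))
      where
      D : ZVec v
      D j = u * x j - P * τ * y j + T y j

      lem₁ : ∀ a b c → a ≡ b - c + (a - b + c)
      lem₁ = solve-∀

      ∑PPy : P * (P * ∑ y) ≡ P * (P * + 0)
      ∑PPy = trans (cong (P *_) (sym (ℤV.∑-*ˡ P y))) (trans (sym (ℤV.∑-*ˡ P (λ j → P * y j)))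
        (trans (sym (ℤV.∑-cong Tx≡)) (trans (∑T x) (lem P))))
        where
        lem : ∀ P → + 0 ≡ P * (P * + 0)
        lem = solve-∀

      TTx : ∀ j → T (T x) j ≡ P * (P * T y j)
      TTx j = trans (T-cong Tx≡ j) (trans (T-* P (λ j → P * y j) j) (cong (P *_) (T-* P y j)))

      PPD : ∀ j → P * (P * D j) ≡ μ * ∑ x
      PPD j = trans (lem₂ P u (x j) τ (y j) (T y j))
        (trans (cong (λ z → P * (P * u) * x j - P * τ * (P * (P * y j)) + z) (trans (sym (TTx j))
          (trans (quadratic x j) (cong (λ z → P * τ * z - P * (P * u) * x j + μ * ∑ x) (Tx≡ j)))))
        (lem₃ (P * (P * u) * x j) (P * τ * (P * (P * y j))) (μ * ∑ x)))
        where
        lem₂ : ∀ P u x τ y t → P * (P * (u * x - P * τ * y + t)) ≡ P * (P * u) * x - P * τ * (P * (P * y)) + P *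
          (P * t)
        lem₂ = solve-∀
        lem₃ : ∀ a b c → a - b + (b - a + c) ≡ c
        lem₃ = solve-∀

    ones : Fin 1 → ZVec v
    ones _ = 𝟙

    ones-independent : Independent ones
    ones-independent c z zero = ≈-trans (≡⇒≈ (lem (c zero))) (z zero)
      where
      lem : ∀ a → a ≡ a * + 1 + + 0
      lem = solve-∀

    -- The quotient of T x by p is contained in the congruence, while for p² it is given explicitly;
    -- these quotients later become basis vectors.
    InM₁ InM₂ : ZVec v → Set
    InM₁ x = ∀ j → T x j ≈ + 0
    InM₂ x = Σ (ZVec v) λ y → ∀ j → T x j ≡ P * (P * y j)

    opaque
      -- Starting from `𝟙` sets it apart as the vector to be omitted later. The added vectors are
      -- some of the `s i`, whose images are divisible by p² over ℤ.
      extension₂ : Extension (λ x → Span s x × InM₂ x) ones s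
      extension₂ = extend _ s ones-independent (λ i → span-∈ i , (λ j → - u * d i j) , T-s i)

    -- b and a will be the numbers of elementary divisors P² and P.
    module X₂ = Extension extension₂
    b = X₂.size

    N₂ : Family (b ℕ.+ 1) v
    N₂ = X₂.new ++ ones

    𝟙∈N₂ : Span N₂ 𝟙
    𝟙∈N₂ = span-++ʳ {u = X₂.new} {w = ones} (span-∈ zero)

    -- The next two lemmas compute the reductions mod p of T⁻¹(P²) and T⁻¹(P³).
    M₂⊆N₂ : ∀ x → InM₂ x → Span N₂ x
    -- Modulo p, `u x` equals `c 𝟙 - T y` with `∑ y` zero, and `u` can be divided out.
    M₂⊆N₂ x (y , Tx≡) = span-unscale u≉0 (span-resp
        (λ j → ≈-sym (mod (τ * y j) (trans (proj₂ (proj₂ pre) j) (lem P τ (y j) (T y j) c))))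
        (span-+ (span-* (- + 1) (span-trans X₂.spans (T-sumZero y (≡⇒≈ (proj₁ pre))))) (span-* c 𝟙∈N₂)))
      where
      pre = preimage-P² x y Tx≡
      c = proj₁ (proj₂ pre)
      lem : ∀ P τ y t c → P * τ * y - t + c ≡ - + 1 * t + c * + 1 + P * (τ * y)
      lem = solve-∀

    M₃⊆ones : ∀ x w → (∀ j → T x j ≡ P * (P * (P * w j))) → Span ones x
    -- Here the quotient by p² is p `w`, so its image vanishes mod p as well and only the constant
    -- vector is left.
    M₃⊆ones x w Tx≡ = span-unscale u≉0 (span (λ _ → c) λ j →
        mod (P * τ * w j - T w j)
          (trans (proj₂ (proj₂ pre) j) (trans (cong (λ z → P * τ * (P * w j) - z + c) (T-* P w j))
          (lem P τ (w j) (T w j) c))))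
      where
      pre = preimage-P² x (λ j → P * w j) Tx≡
      c = proj₁ (proj₂ pre)
      lem : ∀ P τ y t c → P * τ * (P * y) - P * t + c ≡ c * + 1 + + 0 + P * (P * τ * y - t)
      lem = solve-∀

    -- A basis of 𝔽_p^v adapted to the filtration, and the dimension of T(sum-zero vectors).

    module WithRank {e₀ : ℕ} (rank : Rank L e₀) where

      w z : Family e₀ v
      w = proj₁ (proj₁ rank)
      z i = proj₁ (proj₁ (proj₂ (proj₁ rank)) i)

      w≈Tz : ∀ i j → w i j ≈ T (z i) j
      w≈Tz i = proj₂ (proj₁ (proj₂ (proj₁ rank)) i)

      w-independent : Independent w
      w-independent = proj₂ (proj₂ (proj₁ rank))

      opaque
        T∈w : ∀ x → Span w (T x)
        T∈w x = hasDim-spanning {S = 𝔽V.ColumnSpace L} rank (x , λ _ → ≈-refl)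

      Tz-independent : ∀ c → (∀ j → linComb c (λ i → T (z i)) j ≈ + 0) → ∀ i → c i ≈ + 0
      Tz-independent c h = w-independent c (λ j → ≈-trans (𝔽V.linComb-congʳ c w≈Tz j) (h j))

      C : Fin v → Fin e₀ → ℤ
      C j = coeffs (T∈w (δ j))

      -- Standard basis vectors projected to the kernel mod p along the chosen preimages `z`.
      -- Together with `z` they span everything.
      κ : Family v v
      κ j l = δ j l + - + 1 * linComb (C j) z l

      κ∈M₁ : ∀ j → InM₁ (κ j)
      κ∈M₁ j l = begin
        T (κ j) l                                          ≡⟨ T-+ (δ j) (λ l → - + 1 * linComb (C j) z l) l ⟩
        T (δ j) l + T (λ l → - + 1 * linComb (C j) z l) l  ≡⟨ cong (λ x → T (δ j) l + x)
          (trans (T-* (- + 1) (linComb (C j) z) l) (cong (- + 1 *_) (T-linComb (C j) z l))) ⟩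
        T (δ j) l + - + 1 * linComb (C j) (λ i → T (z i)) l ≈⟨ ≈-+
          (≈-trans (expands (T∈w (δ j)) l) (𝔽V.linComb-congʳ (C j) w≈Tz l)) ≈-refl ⟩
        linComb (C j) (λ i → T (z i)) l + - + 1 * linComb (C j) (λ i → T (z i)) l ≡⟨ lem
          (linComb (C j) (λ i → T (z i)) l) ⟩
        + 0 ∎
        where
        lem : ∀ a → a + - + 1 * a ≡ + 0
        lem = solve-∀

      opaque
        -- The `κ j` need not be independent; extending `N₂` by them selects a complement inside the
        -- kernel.
        extension₁ : Extension InM₁ N₂ κ
        extension₁ = extend InM₁ κ X₂.indep κ∈M₁

      module X₁ = Extension extension₁
      a = X₁.size

      N₁ : Family (a ℕ.+ (b ℕ.+ 1)) v
      N₁ = X₁.new ++ N₂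

      N₁∈M₁ : ∀ i → InM₁ (N₁ i)
      N₁∈M₁ = ++-all {Q = InM₁} {u = X₁.new} {w = N₂} X₁.new∈P
        (++-all {Q = InM₁} {u = X₂.new} {w = ones}
          (λ i j → ≈-trans (≡⇒≈ (proj₂ (proj₂ (X₂.new∈P i)) j)) (P*≈0 _))
                (λ _ j → ≡⇒≈ (T𝟙 j)))

      N₀ : Family (e₀ ℕ.+ (a ℕ.+ (b ℕ.+ 1))) v
      N₀ = z ++ N₁

      N₀-spanning : ∀ x → Span N₀ x
      N₀-spanning = span-standard λ j → span-resp (λ l → ≡⇒≈ (lem (δ j l) (linComb (C j) z l)))
        (span-+ (span-++ʳ {u = z} {w = N₁} (X₁.spans j))
          (span-++ˡ {u = z} {w = N₁} (span (C j) (λ _ → ≈-refl))))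
        where
        lem : ∀ a b → a + - + 1 * b + b ≡ a
        lem = solve-∀

      T-combination : ∀ c d l → T (λ j → linComb c z j + linComb d N₁ j) l ≈ linComb c (λ i → T (z i)) l
      T-combination c d l = begin
        T (λ j → linComb c z j + linComb d N₁ j) l       ≡⟨ T-+ (linComb c z) (linComb d N₁) l ⟩
        T (linComb c z) l + T (linComb d N₁) l           ≡⟨ cong₂ _+_ (T-linComb c z l) (T-linComb d N₁ l) ⟩
        linComb c (λ i → T (z i)) l + linComb d (λ i → T (N₁ i)) l
          ≈⟨ ≈-+ (≈-refl {linComb c (λ i → T (z i)) l})
            (≈-trans (𝔽V.linComb-congʳ d N₁∈M₁ l) (≡⇒≈ (ℤV.∑-zero (λ i → ℤₚ.*-zeroʳ (d i))))) ⟩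
        linComb c (λ i → T (z i)) l + + 0                ≡⟨ ℤₚ.+-identityʳ _ ⟩
        linComb c (λ i → T (z i)) l                      ∎

      -- Modulo p, `T` kills `N₁` and is injective on combinations of `z`, so it isolates the
      -- `z`-part.
      z-part-zero : ∀ c d → InM₁ (λ j → linComb c z j + linComb d N₁ j) → ∀ i → c i ≈ + 0
      z-part-zero c d h = Tz-independent c (λ l → ≈-trans (≈-sym (T-combination c d l)) (h l))

      N₀-independent : Independent N₀
      N₀-independent = ++-independent {u = z} {w = N₁} λ c d h →
        let c≈0 = z-part-zero c d (T-zero h) in
        c≈0 , X₁.indep d (λ j → ≈-trans (≡⇒≈ (sym (ℤₚ.+-identityˡ _)))
          (≈-trans (≈-+ (≈-sym (𝔽V.linComb-zero z c≈0 j)) ≈-refl) (h j)))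

      M₁⊆N₁ : ∀ x → InM₁ x → Span N₁ x
      M₁⊆N₁ x Tx≈0 = span c₁ λ j → begin
          x j                                ≈⟨ split j ⟩
          linComb c₀ z j + linComb c₁ N₁ j   ≈⟨ ≈-+ (𝔽V.linComb-zero z c₀≈0 j) ≈-refl ⟩
          + 0 + linComb c₁ N₁ j              ≡⟨ ℤₚ.+-identityˡ _ ⟩
          linComb c₁ N₁ j                    ∎
        where
        c = coeffs (N₀-spanning x)
        c₀ = λ i → c (i ↑ˡ (a ℕ.+ (b ℕ.+ 1)))
        c₁ = λ i → c (e₀ ↑ʳ i)
        split : ∀ j → x j ≈ linComb c₀ z j + linComb c₁ N₁ j
        split j = ≈-trans (expands (N₀-spanning x) j) (𝔽V.linComb-++ c z N₁ j)
        c₀≈0 : ∀ i → c₀ i ≈ + 0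
        c₀≈0 = z-part-zero c₀ c₁ (λ l → ≈-trans (≈-sym (T-cong-≈ split l)) (Tx≈0 l))

      size-N₀ : e₀ ℕ.+ (a ℕ.+ (b ℕ.+ 1)) ≡ v
      size-N₀ = basis-size {w = N₀} N₀-independent N₀-spanning

      ∅ : Family 0 v
      ∅ ()

      opaque
        -- A basis of T(sum-zero vectors) without `𝟙`. Its size `|U|` is compared with `N₂`, which
        -- gives `b + 1` or `b`, and with `w`, which gives e₀ or e₀ - 1.
        basis-s : Extension (Span s) ∅ s
        basis-s = extend (Span s) {u = ∅} s (λ c _ ()) span-∈

      module Uₑ = Extension basis-s

      U : Family (Uₑ.size ℕ.+ 0) v
      U = Uₑ.new ++ ∅

      |U| = Uₑ.size ℕ.+ 0

      U⊆s : ∀ i → Span s (U i)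
      U⊆s = ++-all {Q = Span s} {u = Uₑ.new} {w = ∅} Uₑ.new∈P (λ ())

      U⊆w : ∀ i → Span w (U i)
      U⊆w i = let y , _ , U≈ = span-s⇒T (U⊆s i) in span-resp (λ j → ≈-sym (U≈ j)) (T∈w y)

      N₂⊆𝟙∷s : ∀ {m} {f : Family m v} → (∀ {x} → Span s x → Span f x) → Span f 𝟙 → ∀ i → Span f (N₂ i)
      N₂⊆𝟙∷s {f = f} s⊆f 𝟙∈f = ++-all {Q = Span f} {u = X₂.new} {w = ones} (λ i → s⊆f (proj₁ (X₂.new∈P i)))
        (λ _ → 𝟙∈f)

      s⊆U : ∀ {x} → Span s x → Span U x
      s⊆U = span-trans Uₑ.spans

      U⊆N₂ : ∀ i → Span N₂ (U i)
      U⊆N₂ i = span-trans X₂.spans (U⊆s i)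

      -- `N₂` spans the sum of ⟨𝟙⟩ and the span of `s`, and here the first summand is contained in
      -- the second.
      size-U-𝟙∈s : Span s 𝟙 → |U| ≡ b ℕ.+ 1
      size-U-𝟙∈s 𝟙∈s = size-unique {u = U} {w = N₂} Uₑ.indep X₂.indep U⊆N₂ (N₂⊆𝟙∷s {f = U} s⊆U (s⊆U 𝟙∈s))

      size-U-𝟙∉s : ¬ Span s 𝟙 → suc |U| ≡ b ℕ.+ 1
      size-U-𝟙∉s 𝟙∉s = by (span⊎independent 𝟙 {U} Uₑ.indep)
        where
        by : Span U 𝟙 ⊎ Independent (𝟙 ∷ U) → suc |U| ≡ b ℕ.+ 1
        by (inj₁ 𝟙∈U) = ⊥-elim (𝟙∉s (span-trans U⊆s 𝟙∈U))
        by (inj₂ ind) = size-unique {u = 𝟙 ∷ U} {w = N₂} ind X₂.indep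
          (λ { zero → 𝟙∈N₂ ; (suc i) → U⊆N₂ i })
          (N₂⊆𝟙∷s {f = 𝟙 ∷ U} (λ x∈s → span-there (s⊆U x∈s)) (span-∈ {w = 𝟙 ∷ U} zero))

      ∑-+* : ∀ (x : ZVec v) c (y : ZVec v) → ∑ (λ j → x j + c * y j) ≡ ∑ x + c * ∑ y
      ∑-+* x c y = trans (ℤV.∑-+ x (λ j → c * y j)) (cong (λ t → ∑ x + t) (ℤV.∑-*ˡ c y))

      -- Adding a suitable multiple of `h` gives any preimage sum zero without changing its image
      -- mod p, so the sum-zero vectors already reach the whole column space.
      size-U-ker⊈ : ∀ h → InM₁ h → ¬ ∑ h ≈ + 0 → |U| ≡ e₀
      size-U-ker⊈ h Th≈0 ∑h≉0 = size-unique {u = U} {w = w} Uₑ.indep w-independent U⊆w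
        (λ i → s⊆U (span-resp (Ty≈w i) (T-sumZero (y i) (∑y≈0 i))))
        where
        h⁻¹ = proj₁ (inverse-mod pp ∑h≉0)
        y : Fin e₀ → ZVec v
        y i j = z i j + - (∑ (z i) * h⁻¹) * h j
        Ty≈w : ∀ i j → T (y i) j ≈ w i j
        Ty≈w i j = begin
          T (y i) j                                  ≡⟨ T-+ (z i) (λ j → - (∑ (z i) * h⁻¹) * h j) j ⟩
          T (z i) j + T (λ j → - (∑ (z i) * h⁻¹) * h j) j ≡⟨ cong (λ t → T (z i) j + t)
            (T-* (- (∑ (z i) * h⁻¹)) h j) ⟩
          T (z i) j + - (∑ (z i) * h⁻¹) * T h j      ≈⟨ ≈-+ (≈-sym (w≈Tz i j))
            (≈-* (≈-refl { - (∑ (z i) * h⁻¹)}) (Th≈0 j)) ⟩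
          w i j + - (∑ (z i) * h⁻¹) * + 0            ≡⟨ lem (w i j) (- (∑ (z i) * h⁻¹)) ⟩
          w i j                                      ∎
          where
          lem : ∀ a b → a + b * + 0 ≡ a
          lem = solve-∀
        ∑y≈0 : ∀ i → ∑ (y i) ≈ + 0
        ∑y≈0 i = begin
          ∑ (y i)                                    ≡⟨ ∑-+* (z i) (- (∑ (z i) * h⁻¹)) h ⟩
          ∑ (z i) + - (∑ (z i) * h⁻¹) * ∑ h          ≡⟨ lem (∑ (z i)) h⁻¹ (∑ h) ⟩
          ∑ (z i) + - ∑ (z i) * (h⁻¹ * ∑ h)          ≈⟨ ≈-+ (≈-refl {∑ (z i)})
            (≈-* (≈-refl { - ∑ (z i)}) (proj₂ (inverse-mod pp ∑h≉0))) ⟩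
          ∑ (z i) + - ∑ (z i) * + 1                  ≡⟨ lem′ (∑ (z i)) ⟩
          + 0                                        ∎
          where
          lem : ∀ a b c → a + - (a * b) * c ≡ a + - a * (b * c)
          lem = solve-∀
          lem′ : ∀ a → a + - a * + 1 ≡ + 0
          lem′ = solve-∀

      -- The vector `ε` and the sum-zero vectors span everything, so `T ε` and `U` span the column
      -- space. If `T ε` were the image of a sum-zero `y`, then `ε - y` would be a kernel vector of
      -- sum 1.
      size-U-ker⊆ : (∀ x → InM₁ x → ∑ x ≈ + 0) → suc |U| ≡ e₀
      size-U-ker⊆ ker⊆ = size-unique {u = T ε ∷ U} {w = w} Tε∷U-independent w-independent
          (λ { zero → T∈w ε ; (suc i) → U⊆w i }) w⊆
        where
        ε : ZVec v
        ε = δ zero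
        ∑ε : ∑ ε ≡ + 1
        ∑ε = ∑-δ-row {v} zero

        Tε∉U : ¬ Span U (T ε)
        Tε∉U Tε∈U = DiscreteField.1≉0 (𝔽 pp) (begin
          + 1                            ≡⟨ cong₂ (λ s t → s + - + 1 * t) ∑ε ∑y≡0 ⟨
          ∑ ε + - + 1 * ∑ y              ≡⟨ ∑-+* ε (- + 1) y ⟨
          ∑ (λ j → ε j + - + 1 * y j)    ≈⟨ ker⊆ (λ j → ε j + - + 1 * y j) in-ker ⟩
          + 0                            ∎)
          where
          pre = span-s⇒T (span-trans U⊆s Tε∈U)
          y = proj₁ pre
          ∑y≡0 = proj₁ (proj₂ pre)
          in-ker : InM₁ (λ j → ε j + - + 1 * y j)
          in-ker j = begin
            T (λ j → ε j + - + 1 * y j) j  ≡⟨ trans (T-+ ε (λ j → - + 1 * y j) j)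
              (cong (λ t → T ε j + t) (T-* (- + 1) y j)) ⟩
            T ε j + - + 1 * T y j          ≈⟨ ≈-+ (proj₂ (proj₂ pre) j) (≈-refl { - + 1 * T y j}) ⟩
            T y j + - + 1 * T y j          ≡⟨ lem (T y j) ⟩
            + 0                            ∎
            where
            lem : ∀ a → a + - + 1 * a ≡ + 0
            lem = solve-∀

        Tε∷U-independent : Independent (T ε ∷ U)
        Tε∷U-independent = by (span⊎independent (T ε) {U} Uₑ.indep)
          where
          by : Span U (T ε) ⊎ Independent (T ε ∷ U) → Independent (T ε ∷ U)
          by (inj₁ Tε∈U) = ⊥-elim (Tε∉U Tε∈U)
          by (inj₂ ind)  = ind

        w⊆ : ∀ i → Span (T ε ∷ U) (w i)
        w⊆ i = span-resp Ty+≈w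
          (span-+ {w = T ε ∷ U} (span-there (s⊆U (T-sumZero y (≡⇒≈ ∑y≡0))))
          (span-* (∑ (z i)) (span-∈ {w = T ε ∷ U} zero)))
          where
          y : ZVec v
          y j = z i j + - ∑ (z i) * ε j
          ∑y≡0 : ∑ y ≡ + 0
          ∑y≡0 = trans (∑-+* (z i) (- ∑ (z i)) ε)
            (trans (cong (λ t → ∑ (z i) + - ∑ (z i) * t) ∑ε) (lem (∑ (z i))))
            where
            lem : ∀ a → a + - a * + 1 ≡ + 0
            lem = solve-∀
          Ty+≈w : ∀ j → T y j + ∑ (z i) * T ε j ≈ w i j
          Ty+≈w j = begin
            T y j + ∑ (z i) * T ε j   ≡⟨ cong (λ t → t + ∑ (z i) * T ε j)
              (trans (T-+ (z i) (λ j → - ∑ (z i) * ε j) j) (cong (λ t → T (z i) j + t) (T-* (- ∑ (z i)) ε j))) ⟩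
            T (z i) j + - ∑ (z i) * T ε j + ∑ (z i) * T ε j ≡⟨ lem (T (z i) j) (∑ (z i)) (T ε j) ⟩
            T (z i) j                 ≈⟨ w≈Tz i j ⟨
            w i j                     ∎
            where
            lem : ∀ a b c → a + - b * c + b * c ≡ a
            lem = solve-∀

      -- The sum is linear, so it is enough to test the finitely many vectors of `N₁`, which span
      -- the kernel.
      ker⊈⊎ker⊆ : (Σ (ZVec v) λ h → InM₁ h × ¬ ∑ h ≈ + 0) ⊎ (∀ x → InM₁ x → ∑ x ≈ + 0)
      ker⊈⊎ker⊆ = by (any? (λ i → ¬? (DiscreteField._≈?_ (𝔽 pp) (∑ (N₁ i)) (+ 0))))
        where
        by : Dec (∃ λ i → ¬ ∑ (N₁ i) ≈ + 0) → (Σ (ZVec v) λ h → InM₁ h × ¬ ∑ h ≈ + 0) ⊎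
          (∀ x → InM₁ x → ∑ x ≈ + 0)
        by (yes (i , ∑≉0)) = inj₁ (N₁ i , N₁∈M₁ i , ∑≉0)
        by (no none) = inj₂ λ x Tx≈0 → let c = coeffs (M₁⊆N₁ x Tx≈0) in begin
          ∑ x                      ≈⟨ 𝔽V.∑-cong (expands (M₁⊆N₁ x Tx≈0)) ⟩
          ∑ (linComb c N₁)         ≡⟨ ℤV.∑-linComb c N₁ ⟩
          ∑ (λ i → c i * ∑ (N₁ i)) ≈⟨ 𝔽V.∑-zero
            (λ i → ≈-trans (≈-* (≈-refl {c i})
            (decidable-stable (DiscreteField._≈?_ (𝔽 pp) _ _) (λ h → none (i , h)))) (≡⇒≈ (ℤₚ.*-zeroʳ (c i)))) ⟩
          + 0                      ∎

      -- The relation b + γ = e₀, according to the power of p in v.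

      module Valuation (μv : μ * + v ≡ P * (P * u)) where

        𝟙∉s : ¬ + v ≈ + 0 → ¬ Span s 𝟙
        𝟙∉s v≉0 𝟙∈s = v≉0 (begin
          + v      ≡⟨ ∑-ones v ⟨
          ∑ 𝟙      ≈⟨ 𝔽V.∑-cong (proj₂ (proj₂ pre)) ⟩
          ∑ (T (proj₁ pre)) ≡⟨ ∑T (proj₁ pre) ⟩
          + 0      ∎)
          where pre = span-s⇒T 𝟙∈s

        module Exactly-P {v′ : ℤ} (v≡ : + v ≡ P * v′) (v′≉0 : ¬ v′ ≈ + 0) where

          μv′ : μ * v′ ≡ P * u
          μv′ = P-cancel (trans (lem P μ v′) (trans (cong (μ *_) (sym v≡)) μv))
            where
            lem : ∀ P μ v → P * (μ * v) ≡ μ * (P * v)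
            lem = solve-∀

          -- As `u` is a unit mod p, the product μ v = p² u contains exactly two factors p. One of
          -- them is in `v`, so the other is in `μ`.
          μ≈0 : μ ≈ + 0
          μ≈0 = cancel-unit v′≉0 (≈-trans (≡⇒≈ (trans (ℤₚ.*-comm v′ μ) μv′)) (P*≈0 u))

          μ′ = quot μ≈0

          μ′≉0 : ¬ μ′ ≈ + 0
          μ′≉0 μ′≈0 = u≉0 (begin
            u            ≡⟨ P-cancel
              (trans (sym μv′) (trans (cong (_* v′) (multiple μ≈0)) (ℤₚ.*-assoc P μ′ v′))) ⟩
            μ′ * v′      ≈⟨ ≈-* μ′≈0 (≈-refl {v′}) ⟩
            + 0 * v′     ≡⟨ ℤₚ.*-zeroˡ v′ ⟩
            + 0          ∎)

          -- Write T h = p y; then `y` has sum zero. Dividing the quadratic relation at `h` by p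
          -- leaves T y ≡ μ′ (∑ h) 𝟙, with a unit in front of `𝟙`.
          𝟙∈s-if : ∀ h → InM₁ h → ¬ ∑ h ≈ + 0 → Span s 𝟙
          𝟙∈s-if h Th≈0 ∑h≉0 = span-unscale c≉0 (span-resp Ty≈ (T-sumZero y (≡⇒≈ ∑y≡0)))
            where
            y : ZVec v
            y j = quot (Th≈0 j)
            c = μ′ * ∑ h
            c≉0 : ¬ c ≈ + 0
            c≉0 c≈0 = ∑h≉0 (cancel-unit μ′≉0 c≈0)
            ∑y≡0 : ∑ y ≡ + 0
            ∑y≡0 = P-cancel (trans (sym (ℤV.∑-*ˡ P y))
              (trans (sym (ℤV.∑-cong (λ j → multiple (Th≈0 j)))) (trans (∑T h) (sym (ℤₚ.*-zeroʳ P)))))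
            Ty≈ : ∀ j → T y j ≈ c * + 1
            Ty≈ j = mod (τ * y j - u * h j) (P-cancel (trans (sym (T-* P y j))
              (trans (T-cong (λ j → sym (multiple (Th≈0 j))) j) (trans (quadratic h j)
              (trans (cong₂ (λ t m → P * τ * t - P * (P * u) * h j + m * ∑ h) (multiple (Th≈0 j))
                (multiple μ≈0))
                     (lem P τ (y j) u (h j) μ′ (∑ h)))))))
              where
              lem : ∀ P τ y u h m s → P * τ * (P * y) - P * (P * u) * h + P * m * s ≡ P *
                (m * s * + 1 + P * (τ * y - u * h))
              lem = solve-∀

          -- Suppose 𝟙 = T y + p q with ∑ y = 0. Applying `T` and dividing by p gives T (q + τ y) =
          -- p u y, so `q + τ y` is in the kernel mod p. Its sum is ∑ q = v / p = `v′`, a unit.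
          𝟙∉s-if : (∀ x → InM₁ x → ∑ x ≈ + 0) → ¬ Span s 𝟙
          𝟙∉s-if ker⊆ 𝟙∈s = v′≉0 (begin
            v′                             ≡⟨ P-cancel (trans (sym v≡) (sym P∑q)) ⟩
            ∑ q                            ≡⟨ lem₁ (∑ q) τ ⟩
            ∑ q + τ * + 0                  ≡⟨ cong (λ t → ∑ q + τ * t) (proj₁ (proj₂ pre)) ⟨
            ∑ q + τ * ∑ y                  ≡⟨ ∑-+* q τ y ⟨
            ∑ (λ j → q j + τ * y j)        ≈⟨ ker⊆ (λ j → q j + τ * y j) in-ker ⟩
            + 0                            ∎)
            where
            pre = span-s⇒T 𝟙∈s
            y = proj₁ pre
            1≈Ty = proj₂ (proj₂ pre)
            q : ZVec v
            q j = quot (1≈Ty j)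
            lem₁ : ∀ a b → a ≡ a + b * + 0
            lem₁ = solve-∀
            P∑q : P * ∑ q ≡ + v
            P∑q = trans (sym (ℤₚ.+-identityˡ _)) (trans (cong (_+ P * ∑ q) (sym (∑T y)))
              (trans (sym (∑-+* (T y) P q)) (trans (sym (ℤV.∑-cong (λ j → eq (1≈Ty j)))) (∑-ones v))))
            in-ker : InM₁ (λ j → q j + τ * y j)
            in-ker j = mod (u * y j)
              (P-cancel (trans (cong (P *_)
              (trans (T-+ q (λ j → τ * y j) j) (cong (λ t → T q j + t) (T-* τ y j))))
              (trans (lem₂ P (T q j) τ (T y j) (P * (P * u) * y j) μ)
              (trans (cong₂ (λ t s → t + P * T q j + P * (P * u) * y j + - (μ * s))
                (sym (trans (quadratic y j)
                (cong (λ s → P * τ * T y j - P * (P * u) * y j + μ * s) (proj₁ (proj₂ pre)))))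
                (sym (proj₁ (proj₂ pre))))
              (trans (cong (λ t → t + P * (P * u) * y j + - (μ * ∑ y)) T1)
              (trans (cong (λ s → + 0 + P * (P * u) * y j + - (μ * s)) (proj₁ (proj₂ pre)))
                (lem₃ P u (y j) μ)))))))
              where
              T1 : T (T y) j + P * T q j ≡ + 0
              T1 = trans (cong (λ t → T (T y) j + t) (sym (T-* P q j)))
                (trans (sym (T-+ (T y) (λ j → P * q j) j))
                (trans (T-cong (λ j → sym (eq (1≈Ty j))) j) (T𝟙 j)))
              lem₂ : ∀ P a τ b c μ → P * (a + τ * b) ≡ P * τ * b - c + μ * + 0 + P * a + c + - (μ * + 0)
              lem₂ = solve-∀
              lem₃ : ∀ P u y μ → + 0 + P * (P * u) * y + - (μ * + 0) ≡ P * (+ 0 + P * (u * y))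
              lem₃ = solve-∀

          -- In both cases `|U|` falls short of `b + 1` and of `e₀` by the same amount: by 0 in one
          -- case, by 1 in the other.
          count : b ℕ.+ 1 ≡ e₀
          count = by ker⊈⊎ker⊆
            where
            by : (Σ (ZVec v) λ h → InM₁ h × ¬ ∑ h ≈ + 0) ⊎ (∀ x → InM₁ x → ∑ x ≈ + 0) → b ℕ.+ 1 ≡ e₀
            by (inj₁ (h , Th≈0 , ∑h≉0)) = trans (sym (size-U-𝟙∈s (𝟙∈s-if h Th≈0 ∑h≉0)))
              (size-U-ker⊈ h Th≈0 ∑h≉0)
            by (inj₂ ker⊆) = trans (sym (size-U-𝟙∉s (𝟙∉s-if ker⊆))) (size-U-ker⊆ ker⊆)

        module Exactly-P² {v′ : ℤ} (v≡ : + v ≡ P * (P * v′)) where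

          μ≉0 : ¬ μ ≈ + 0
          μ≉0 μ≈0 = u≉0 (begin
            u            ≡⟨ P-cancel (P-cancel (trans (sym μv) (trans (cong (μ *_) v≡) (lem P μ v′)))) ⟩
            μ * v′       ≈⟨ ≈-* μ≈0 (≈-refl {v′}) ⟩
            + 0 * v′     ≡⟨ ℤₚ.*-zeroˡ v′ ⟩
            + 0          ∎)
            where
            lem : ∀ P μ v → μ * (P * (P * v)) ≡ P * (P * (μ * v))
            lem = solve-∀

          -- Modulo p only the `μ`-term survives, and `μ` is a unit because `v` contains both
          -- factors p of p² u. Hence kernel vectors have sum zero, and `𝟙` is a multiple of T (T (δ
          -- zero)), where T (δ zero) has sum zero.
          TT≈ : ∀ x j → T (T x) j ≈ μ * ∑ x
          TT≈ x j = mod (τ * T x j - P * u * x j) (trans (quadratic x j) (lem P τ (T x j) u (x j) (μ * ∑ x)))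
            where
            lem : ∀ P τ t u x m → P * τ * t - P * (P * u) * x + m ≡ m + P * (τ * t - P * u * x)
            lem = solve-∀

          ker⊆ : ∀ x → InM₁ x → ∑ x ≈ + 0
          ker⊆ x Tx≈0 = cancel-unit μ≉0 (≈-trans (≈-sym (TT≈ x zero)) (T-zero Tx≈0 zero))

          𝟙∈s : Span s 𝟙
          𝟙∈s = span-unscale μ≉0
            (span-resp (λ j → ≈-trans (TT≈ (δ zero) j) (≡⇒≈ (cong (μ *_) (∑-δ-row {v} zero))))
            (T-sumZero (T (δ zero)) (≡⇒≈ (∑T (δ zero)))))

          count : b ℕ.+ 2 ≡ e₀
          count = trans (ℕₚ.+-suc b 1) (trans (cong suc (sym (size-U-𝟙∈s 𝟙∈s))) (size-U-ker⊆ ker⊆))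

        count : ∀ γ → (p ℕ.^ γ) ℕD.∣ v → ¬ (p ℕ.^ suc γ) ℕD.∣ v → b ℕ.+ γ ≡ e₀
        count γ (ℕD.divides q v≡) ¬∣ = by γ v≡ q≉0
          where
          q≉0 : ¬ + q ≈ + 0
          q≉0 q≈0 = ¬∣ (subst ((p ℕ.^ suc γ) ℕD.∣_) (sym v≡) (ℕD.*-monoˡ-∣ (p ℕ.^ γ) (≈0⇒∣ q≈0)))

          cast : ∀ x → v ≡ q ℕ.* (p ℕ.* x) → + v ≡ P * (+ q * + x)
          cast x e = trans (cong +_ e)
            (trans (ℤₚ.pos-* q (p ℕ.* x)) (trans (cong (+ q *_) (ℤₚ.pos-* p x)) (lem P (+ q) (+ x))))
            where
            lem : ∀ P q x → q * (P * x) ≡ P * (q * x)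
            lem = solve-∀

          cast² : ∀ x → v ≡ q ℕ.* (p ℕ.* (p ℕ.* x)) → + v ≡ P * (P * (+ q * + x))
          cast² x e = trans (cast (p ℕ.* x) e)
            (trans (cong (λ t → P * (+ q * t)) (ℤₚ.pos-* p x)) (lem P (+ q) (+ x)))
            where
            lem : ∀ P q x → P * (q * (P * x)) ≡ P * (P * (q * x))
            lem = solve-∀

          q*1≉0 : ¬ + q ≈ + 0 → ¬ + q * + 1 ≈ + 0
          q*1≉0 h = subst (λ t → ¬ t ≈ + 0) (sym (ℤₚ.*-identityʳ (+ q))) h

          by : ∀ γ → v ≡ q ℕ.* (p ℕ.^ γ) → ¬ + q ≈ + 0 → b ℕ.+ γ ≡ e₀
          -- With `v` a unit mod p, `𝟙` is a kernel vector of nonzero sum, and for the same reason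
          -- it is no image vector.
          by 0 e q≉0 = trans (ℕₚ.+-identityʳ b)
            (ℕₚ.suc-injective (trans (trans (sym (ℕₚ.+-comm b 1)) (sym (size-U-𝟙∉s (𝟙∉s v≉0))))
              (cong suc (size-U-ker⊈ 𝟙 (λ j → ≡⇒≈ (T𝟙 j)) (subst (λ t → ¬ t ≈ + 0) (sym (∑-ones v)) v≉0)))))
            where
            v≉0 : ¬ + v ≈ + 0
            v≉0 = subst (λ t → ¬ + t ≈ + 0) (trans (sym (ℕₚ.*-identityʳ q)) (sym e)) q≉0
          by 1 e q≉0 = Exactly-P.count (cast 1 e) (q*1≉0 q≉0)
          by 2 e q≉0 = Exactly-P².count (cast² 1 e)
          -- If p³ divided `v`, then μ v = p² u would make p divide `u`.
          by (suc (suc (suc γ))) e q≉0 = ⊥-elim (u≉0 (≈-trans (≡⇒≈ (P-cancel (P-cancel (trans (sym μv)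
              (trans (cong (μ *_) (trans (cast² (p ℕ.* p ℕ.^ γ) e)
                (cong (λ t → P * (P * (+ q * t))) (ℤₚ.pos-* p (p ℕ.^ γ)))))
                     (lem P μ (+ q) (+ (p ℕ.^ γ)))))))) (P*≈0 (μ * + q * + (p ℕ.^ γ)))))
            where
            lem : ∀ P μ q x → μ * (P * (P * (q * (P * x)))) ≡ P * (P * (P * (μ * q * x)))
            lem = solve-∀

      -- The images divided by 1, p and p² form a basis mod p of the sum-zero vectors.

      Y₀ : Family e₀ v
      Y₀ i = T (z i)

      Y₁ : Family a v
      Y₁ i j = quot (X₁.new∈P i j)

      Y₂ : Family b v
      Y₂ i = proj₁ (proj₂ (X₂.new∈P i))

      T-X₁ : ∀ c j → T (linComb c X₁.new) j ≡ P * linComb c Y₁ j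
      T-X₁ c j = trans (T-linComb c X₁.new j)
        (trans (ℤV.linComb-congʳ c (λ i j → multiple (X₁.new∈P i j)) j) (ℤV.linComb-*ʳ P c Y₁ j))

      T-X₂ : ∀ c j → T (linComb c X₂.new) j ≡ P * (P * linComb c Y₂ j)
      T-X₂ c j = trans (T-linComb c X₂.new j) (trans (ℤV.linComb-congʳ c (λ i → proj₂ (proj₂ (X₂.new∈P i))) j)
        (trans (ℤV.linComb-*ʳ P c (λ i j → P * Y₂ i j) j) (cong (P *_) (ℤV.linComb-*ʳ P c Y₂ j))))

      comb : (Fin e₀ → ℤ) → (Fin a → ℤ) → (Fin b → ℤ) → ZVec v
      comb c₀ c₁ c₂ j = linComb c₀ Y₀ j + linComb c₁ Y₁ j + linComb c₂ Y₂ j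

      linComb-multiple : ∀ {m} {c : Fin m → ℤ} (y : Family m v) (h : ∀ i → c i ≈ + 0) j →
                         linComb c y j ≡ P * linComb (λ i → quot (h i)) y j
      linComb-multiple y h j = trans (ℤV.linComb-congˡ y (λ i → multiple (h i)) j) (ℤV.linComb-*ˡ P _ y j)

      -- Divisibility of c₂, then c₁, then c₀ follows by lifting the relation to a vector that T sends into P³, P², P.
      Y-independent : ∀ c₀ c₁ c₂ → (∀ j → comb c₀ c₁ c₂ j ≈ + 0) →
                      (∀ i → c₀ i ≈ + 0) × (∀ i → c₁ i ≈ + 0) × (∀ i → c₂ i ≈ + 0)
      Y-independent c₀ c₁ c₂ h = c₀≈0 , c₁≈0 , c₂≈0
        where
        A₀ A₁ A₂ B₀ B₁ B₂ q : ZVec v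
        A₀ = linComb c₀ z
        A₁ = linComb c₁ X₁.new
        A₂ = linComb c₂ X₂.new
        B₀ = linComb c₀ Y₀
        B₁ = linComb c₁ Y₁
        B₂ = linComb c₂ Y₂
        q j = quot (h j)

        T-A₁ : ∀ j → T A₁ j ≡ P * B₁ j
        T-A₁ = T-X₁ c₁

        -- The weights p², p and 1 compensate for the divisions in `Y₀`, `Y₁` and `Y₂`: `T x₃` is p²
        -- times the given combination, and the congruence supplies the third factor p.
        x₃ : ZVec v
        x₃ j = P * (P * A₀ j) + (P * A₁ j + A₂ j)

        T-x₃ : ∀ j → T x₃ j ≡ P * (P * (P * q j))
        T-x₃ j = trans (T-+ (λ j → P * (P * A₀ j)) (λ j → P * A₁ j + A₂ j) j)
          (trans (cong₂ _+_ (trans (T-* P (λ j → P * A₀ j) j)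
            (cong (P *_) (trans (T-* P A₀ j) (cong (P *_) (T-linComb c₀ z j)))))
                            (trans (T-+ (λ j → P * A₁ j) A₂ j)
                              (cong₂ _+_ (trans (T-* P A₁ j) (cong (P *_) (T-A₁ j))) (T-X₂ c₂ j))))
          (trans (lem P (B₀ j) (B₁ j) (B₂ j)) (cong (λ t → P * (P * t)) (multiple (h j)))))
          where
          lem : ∀ P x y z → P * (P * x) + (P * (P * y) + P * (P * z)) ≡ P * (P * (x + y + z))
          lem = solve-∀

        c₂≈0 : ∀ i → c₂ i ≈ + 0
        c₂≈0 = independent-++-span {u = X₂.new} {w = ones} X₂.indep c₂ (span-resp
          (λ j → mod (P * A₀ j + A₁ j) (lem P (A₀ j) (A₁ j) (A₂ j))) (M₃⊆ones x₃ q T-x₃))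
          where
          lem : ∀ P x y z → P * (P * x) + (P * y + z) ≡ z + P * (P * x + y)
          lem = solve-∀

        q₂ : Fin b → ℤ
        q₂ i = quot (c₂≈0 i)

        x₂ : ZVec v
        x₂ j = P * A₀ j + A₁ j

        -- Once `c₂` is p times `q₂`, the `Y₂`-part moves to the right-hand side, and the remaining
        -- parts need only the weights p and 1.
        T-x₂ : ∀ j → T x₂ j ≡ P * (P * (q j - linComb q₂ Y₂ j))
        T-x₂ j = trans (T-+ (λ j → P * A₀ j) A₁ j)
          (trans (cong₂ _+_ (trans (T-* P A₀ j) (cong (P *_) (T-linComb c₀ z j))) (T-A₁ j))
          (trans (lem P (B₀ j) (B₁ j) (B₂ j))
          (trans (cong₂ (λ s t → P * (s - t)) (multiple (h j)) (linComb-multiple Y₂ c₂≈0 j))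
            (lem′ P (q j) (linComb q₂ Y₂ j)))))
          where
          lem : ∀ P x y z → P * x + P * y ≡ P * (x + y + z - z)
          lem = solve-∀
          lem′ : ∀ P x y → P * (P * x - P * y) ≡ P * (P * (x - y))
          lem′ = solve-∀

        c₁≈0 : ∀ i → c₁ i ≈ + 0
        c₁≈0 = independent-++-span {u = X₁.new} {w = N₂} X₁.indep c₁ (span-resp
          (λ j → mod (A₀ j) (ℤₚ.+-comm (P * A₀ j) (A₁ j))) (M₂⊆N₂ x₂ ((λ j → q j - linComb q₂ Y₂ j) , T-x₂)))

        c₀≈0 : ∀ i → c₀ i ≈ + 0
        c₀≈0 = Tz-independent c₀ λ j → ≈-trans (≡⇒≈ (lem (B₀ j) (B₁ j) (B₂ j)))
          (≈-+ (≈-+ (h j) (≈-neg (𝔽V.linComb-zero Y₁ c₁≈0 j))) (≈-neg (𝔽V.linComb-zero Y₂ c₂≈0 j)))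
          where
          lem : ∀ x y z → x ≡ x + y + z - y - z
          lem = solve-∀

      comb-+P : ∀ c₀ c₁ c₂ d₀ d₁ d₂ j →
                comb (λ i → c₀ i + P * d₀ i) (λ i → c₁ i + P * d₁ i)
                  (λ i → c₂ i + P * d₂ i) j ≡ comb c₀ c₁ c₂ j + P * comb d₀ d₁ d₂ j
      comb-+P c₀ c₁ c₂ d₀ d₁ d₂ j = trans
        (cong₂ _+_ (cong₂ _+_ (affine Y₀ c₀ d₀) (affine Y₁ c₁ d₁)) (affine Y₂ c₂ d₂))
          (lem P (linComb c₀ Y₀ j) (linComb c₁ Y₁ j) (linComb c₂ Y₂ j) (linComb d₀ Y₀ j) (linComb d₁ Y₁ j)
            (linComb d₂ Y₂ j))
        where
        affine : ∀ {m} (y : Family m v) c d → linComb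
          (λ i → c i + P * d i) y j ≡ linComb c y j + P * linComb d y j
        affine y c d = trans (ℤV.linComb-+ c (λ i → P * d i) y j)
          (cong (λ t → linComb c y j + t) (ℤV.linComb-*ˡ P d y j))
        lem : ∀ P x y z x′ y′ z′ → x + P * x′ + (y + P * y′) + (z + P * z′) ≡ x + y + z + P * (x′ + y′ + z′)
        lem = solve-∀

      -- Independence mod p makes all coefficients divisible by p. Their quotients satisfy the
      -- relation divided by p, so independence applies again.
      Y-independent² : ∀ c₀ c₁ c₂ (x : ZVec v) → (∀ j → comb c₀ c₁ c₂ j ≡ P * (P * x j)) →
                       (∀ i → Σ ℤ λ q → c₁ i ≡ P * (P * q)) × (∀ i → Σ ℤ λ q → c₂ i ≡ P * (P * q))
      Y-independent² c₀ c₁ c₂ x h =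
          (λ i → quot (proj₁ (proj₂ second) i) , trans (multiple (proj₁ (proj₂ first) i))
            (cong (P *_) (multiple (proj₁ (proj₂ second) i)))) ,
          (λ i → quot (proj₂ (proj₂ second) i) , trans (multiple (proj₂ (proj₂ first) i))
            (cong (P *_) (multiple (proj₂ (proj₂ second) i))))
        where
        first = Y-independent c₀ c₁ c₂ (λ j → ≈-trans (≡⇒≈ (h j)) (P*≈0 (P * x j)))
        second = Y-independent (λ i → quot (proj₁ first i)) (λ i → quot (proj₁ (proj₂ first) i))
          (λ i → quot (proj₂ (proj₂ first) i))
          (λ j → ≈-trans (≡⇒≈ (P-cancel (trans (sym (divided j)) (h j)))) (P*≈0 (x j)))
          where
          divided : ∀ j → comb c₀ c₁ c₂ j ≡ P * comb (λ i → quot (proj₁ first i))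
            (λ i → quot (proj₁ (proj₂ first) i)) (λ i → quot (proj₂ (proj₂ first) i)) j
          divided j = trans (cong₂ _+_
            (cong₂ _+_ (linComb-multiple Y₀ (proj₁ first) j) (linComb-multiple Y₁ (proj₁ (proj₂ first)) j))
            (linComb-multiple Y₂ (proj₂ (proj₂ first)) j))
            (lem P (linComb (λ i → quot (proj₁ first i)) Y₀ j)
              (linComb (λ i → quot (proj₁ (proj₂ first) i)) Y₁ j)
              (linComb (λ i → quot (proj₂ (proj₂ first) i)) Y₂ j))
            where
            lem : ∀ P x y z → P * x + P * y + P * z ≡ P * (x + y + z)
            lem = solve-∀

      ∑Y₁ : ∀ i → ∑ (Y₁ i) ≡ + 0
      ∑Y₁ i = P-cancel (trans (sym (ℤV.∑-*ˡ P (Y₁ i))) (trans (sym (ℤV.∑-cong (λ j → multiple (X₁.new∈P i j))))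
        (trans (∑T (X₁.new i)) (sym (ℤₚ.*-zeroʳ P)))))

      ∑Y₂ : ∀ i → ∑ (Y₂ i) ≡ + 0
      ∑Y₂ i = proj₁ (preimage-P² (X₂.new i) (Y₂ i) (proj₂ (proj₂ (X₂.new∈P i))))

      Y : Family (e₀ ℕ.+ (a ℕ.+ b)) v
      Y = Y₀ ++ (Y₁ ++ Y₂)

      ∑Y : ∀ i → ∑ (Y i) ≡ + 0
      ∑Y = ++-all {Q = λ y → ∑ y ≡ + 0} {u = Y₀} {w = Y₁ ++ Y₂} (λ i → ∑T (z i))
        (++-all {Q = λ y → ∑ y ≡ + 0} {u = Y₁} {w = Y₂} ∑Y₁ ∑Y₂)

      ∑-linComb-Y : ∀ c → ∑ (linComb c Y) ≡ + 0
      ∑-linComb-Y c = trans (ℤV.∑-linComb c Y)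
        (ℤV.∑-zero (λ i → trans (cong (c i *_) (∑Y i)) (ℤₚ.*-zeroʳ (c i))))

      Y-split : ∀ c j → linComb c Y j ≡ comb (λ i → c (i ↑ˡ (a ℕ.+ b))) (λ i → c (e₀ ↑ʳ (i ↑ˡ b)))
        (λ i → c (e₀ ↑ʳ (a ↑ʳ i))) j
      Y-split c j = trans (ℤV.linComb-++ c Y₀ (Y₁ ++ Y₂) j)
        (trans (cong (λ t → linComb (λ i → c (i ↑ˡ (a ℕ.+ b))) Y₀ j + t)
          (ℤV.linComb-++ (λ i → c (e₀ ↑ʳ i)) Y₁ Y₂ j))
               (sym (ℤₚ.+-assoc (linComb (λ i → c (i ↑ˡ (a ℕ.+ b))) Y₀ j)
                 (linComb (λ i → c (e₀ ↑ʳ (i ↑ˡ b))) Y₁ j) (linComb (λ i → c (e₀ ↑ʳ (a ↑ʳ i))) Y₂ j))))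

      Y-family-independent : Independent Y
      Y-family-independent = ++-independent {u = Y₀} {w = Y₁ ++ Y₂} λ c d h →
        let hs = Y-independent c (λ i → d (i ↑ˡ b)) (λ i → d (a ↑ʳ i)) (λ j → ≈-trans (≡⇒≈ (trans
                   (ℤₚ.+-assoc (linComb c Y₀ j) (linComb (λ i → d (i ↑ˡ b)) Y₁ j)
                     (linComb (λ i → d (a ↑ʳ i)) Y₂ j))
                   (cong (λ t → linComb c Y₀ j + t) (sym (ℤV.linComb-++ d Y₁ Y₂ j))))) (h j))
        in proj₁ hs , λ i → subst (λ k → d k ≈ + 0) (join-splitAt a b i)
          (cases {d} (proj₁ (proj₂ hs)) (proj₂ (proj₂ hs)) (splitAt a i))
        where
        cases : ∀ {d : Fin (a ℕ.+ b) → ℤ} → (∀ i → d (i ↑ˡ b) ≈ + 0) → (∀ i → d (a ↑ʳ i) ≈ + 0) → ∀ k → d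
          (join a b k) ≈ + 0
        cases h₁ h₂ (inj₁ k) = h₁ k
        cases h₁ h₂ (inj₂ k) = h₂ k

      -- Adjoining `δ zero` to `y` gives a basis of 𝔽_p^v, in which the coefficient of `δ zero` is
      -- the sum of the vector; for sum-zero vectors it drops out.
      module SumZero {m : ℕ} {y : Family m v} (∑y : ∀ i → ∑ (y i) ≡ + 0) (y-independent : Independent y)
        (size : suc m ≡ v) where

        ∑-coefficient : ∀ c → ∑ (linComb c (δ zero ∷ y)) ≡ c zero
        ∑-coefficient c = trans (ℤV.∑-linComb c (δ zero ∷ y)) (trans (cong₂ _+_
          (cong (c zero *_) (∑-δ-row {v} zero))
            (ℤV.∑-zero (λ i → trans (cong (c (suc i) *_) (∑y i)) (ℤₚ.*-zeroʳ (c (suc i))))))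
          (lem (c zero)))
          where
          lem : ∀ a → a * + 1 + + 0 ≡ a
          lem = solve-∀

        drop-zero : ∀ c → c zero ≈ + 0 → ∀ j → linComb c (δ zero ∷ y) j ≈ linComb (c ∘ suc) y j
        drop-zero c c₀≈0 j = begin
          c zero * δ zero j + linComb (c ∘ suc) y j  ≈⟨ ≈-+ (≈-* c₀≈0 (≈-refl {δ zero j}))
            (≈-refl {linComb (c ∘ suc) y j}) ⟩
          + 0 * δ zero j + linComb (c ∘ suc) y j     ≡⟨ lem (δ zero j) (linComb (c ∘ suc) y j) ⟩
          linComb (c ∘ suc) y j                      ∎
          where
          lem : ∀ a b → + 0 * a + b ≡ b
          lem = solve-∀

        ∷-independent : Independent (δ zero ∷ y)
        ∷-independent c h = λ { zero → c₀≈0 ; (suc i) → y-independent (c ∘ suc)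
          (λ j → ≈-trans (≈-sym (drop-zero c c₀≈0 j)) (h j)) i }
          where
          c₀≈0 : c zero ≈ + 0
          c₀≈0 = ≈-trans (≡⇒≈ (sym (∑-coefficient c))) (𝔽V.∑-zero h)

        spans : ∀ x → ∑ x ≡ + 0 → Span y x
        spans x ∑x≡0 = span (c ∘ suc) λ j → ≈-trans (x≈ j) (drop-zero c c₀≈0 j)
          where
          sp = independent⇒spanning {w = δ zero ∷ y} size ∷-independent x
          c = coeffs sp
          x≈ = expands sp
          c₀≈0 : c zero ≈ + 0
          c₀≈0 = ≈-trans (≡⇒≈ (sym (∑-coefficient c))) (≈-trans (≈-sym (𝔽V.∑-cong x≈)) (≡⇒≈ ∑x≡0))

      -- The remainder again has sum zero, so it can be expanded in turn; `m` is p after one round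
      -- and p² after two.
      record Expansion (x : ZVec v) (m : ℤ) : Set where
        constructor expansion
        field
          c₀   : Fin e₀ → ℤ
          c₁   : Fin a → ℤ
          c₂   : Fin b → ℤ
          rest : ZVec v
          ∑rest : ∑ rest ≡ + 0
          expands : ∀ j → x j ≡ comb c₀ c₁ c₂ j + m * rest j

      opaque
        Y-expand : ∀ x → ∑ x ≡ + 0 → Expansion x P
        Y-expand x ∑x≡0 = expansion (λ i → c (i ↑ˡ (a ℕ.+ b))) (λ i → c (e₀ ↑ʳ (i ↑ˡ b)))
          (λ i → c (e₀ ↑ʳ (a ↑ʳ i))) rest ∑rest
            (λ j → trans (eq (expands sp j)) (cong (λ t → t + P * rest j) (Y-split c j)))
          where
          size : suc (e₀ ℕ.+ (a ℕ.+ b)) ≡ v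
          size = trans (trans (cong suc (sym (ℕₚ.+-assoc e₀ a b)))
            (trans (ℕₚ.+-comm 1 _) (trans (ℕₚ.+-assoc (e₀ ℕ.+ a) b 1) (ℕₚ.+-assoc e₀ a (b ℕ.+ 1))))) size-N₀
          sp : Span Y x
          sp = SumZero.spans {y = Y} ∑Y Y-family-independent size x ∑x≡0
          c : Fin (e₀ ℕ.+ (a ℕ.+ b)) → ℤ
          c = coeffs sp
          rest : ZVec v
          rest j = quot (expands sp j)
          ∑rest : ∑ rest ≡ + 0
          ∑rest = P-cancel (trans (sym (ℤₚ.+-identityˡ (P * ∑ rest)))
            (trans (cong (_+ P * ∑ rest) (sym (∑-linComb-Y c)))
            (trans (sym (∑-+* (linComb c Y) P rest))
              (trans (sym (ℤV.∑-cong (λ j → eq (expands sp j)))) (trans ∑x≡0 (sym (ℤₚ.*-zeroʳ P)))))))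

      Y-expand² : ∀ x → ∑ x ≡ + 0 → Expansion x (P * P)
      Y-expand² x ∑x≡0 = expansion (λ i → E₁.c₀ i + P * E₂.c₀ i) (λ i → E₁.c₁ i + P * E₂.c₁ i)
        (λ i → E₁.c₂ i + P * E₂.c₂ i) E₂.rest E₂.∑rest λ j →
          trans (E₁.expands j) (trans (cong (λ t → comb E₁.c₀ E₁.c₁ E₁.c₂ j + P * t) (E₂.expands j))
            (trans (lem (comb E₁.c₀ E₁.c₁ E₁.c₂ j) P (comb E₂.c₀ E₂.c₁ E₂.c₂ j) (E₂.rest j))
              (cong (λ t → t + P * P * E₂.rest j) (sym (comb-+P E₁.c₀ E₁.c₁ E₁.c₂ E₂.c₀ E₂.c₁ E₂.c₂ j)))))
        where
        module E₁ = Expansion (Y-expand x ∑x≡0)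
        module E₂ = Expansion (Y-expand E₁.rest E₁.∑rest)
        lem : ∀ a P b r → a + P * (b + P * r) ≡ a + P * b + P * P * r
        lem = solve-∀

      -- Modulo `m` this is the diagonal form of `T` from the adapted basis to `Y`, with entries 1,
      -- p, p², and 0 at `𝟙`. The remainder is kept as an image so that the expansion can be
      -- repeated.
      record TExpansion (x : ZVec v) (m : ℤ) : Set where
        constructor expansion
        field
          c₀ : Fin e₀ → ℤ
          c₁ : Fin a → ℤ
          c₂ : Fin b → ℤ
          P∣c₁ : ∀ i → Σ ℤ λ q → c₁ i ≡ P * q
          P²∣c₂ : ∀ i → Σ ℤ λ q → c₂ i ≡ P * (P * q)
          rest : ZVec v
          T-expands : ∀ j → T x j ≡ comb c₀ c₁ c₂ j + m * T rest j

      T-sum₄ : ∀ x₀ x₁ x₂ x₃ r j → T (λ j → x₀ j + (x₁ j + (x₂ j + x₃ j)) + P * r j) j ≡ T x₀ j +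
        (T x₁ j + (T x₂ j + T x₃ j)) + P * T r j
      T-sum₄ x₀ x₁ x₂ x₃ r j = trans (T-+ (λ j → x₀ j + (x₁ j + (x₂ j + x₃ j))) (λ j → P * r j) j) (cong₂ _+_
        (trans (T-+ x₀ (λ j → x₁ j + (x₂ j + x₃ j)) j) (cong (λ t → T x₀ j + t)
          (trans (T-+ x₁ (λ j → x₂ j + x₃ j) j) (cong (λ t → T x₁ j + t) (T-+ x₂ x₃ j)))))
        (T-* P r j))

      sum₄ : ∀ {t₀ t₁ t₂ t₃ y₀ y₁ y₂ : ℤ} r → t₀ ≡ y₀ → t₁ ≡ y₁ → t₂ ≡ y₂ → t₃ ≡ + 0 → t₀ +
        (t₁ + (t₂ + t₃)) + r ≡ y₀ + y₁ + y₂ + r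
      sum₄ {t₀} {t₁} {t₂} r refl refl refl refl = lem t₀ t₁ t₂ r
        where
        lem : ∀ a b c r → a + (b + (c + + 0)) + r ≡ a + b + c + r
        lem = solve-∀

      opaque
        -- Expand `x` in `N₀` and apply `T`: the `𝟙`-part disappears, and the divisions that define
        -- `Y₁` and `Y₂` return as factors p and p².
        T-expand : ∀ x → TExpansion x P
        T-expand x = expansion c₀ (λ i → P * c₁ i) (λ i → P * (P * c₂ i)) (λ i → c₁ i , refl)
          (λ i → c₂ i , refl) rest expanded
          where
          sp : Span N₀ x
          sp = N₀-spanning x
          c : Fin (e₀ ℕ.+ (a ℕ.+ (b ℕ.+ 1))) → ℤ
          c = coeffs sp
          c₀ : Fin e₀ → ℤ
          c₀ i = c (i ↑ˡ (a ℕ.+ (b ℕ.+ 1)))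
          c₁ : Fin a → ℤ
          c₁ i = c (e₀ ↑ʳ (i ↑ˡ (b ℕ.+ 1)))
          c₂ : Fin b → ℤ
          c₂ i = c (e₀ ↑ʳ (a ↑ʳ (i ↑ˡ 1)))
          c₃ : Fin 1 → ℤ
          c₃ i = c (e₀ ↑ʳ (a ↑ʳ (b ↑ʳ i)))
          rest : ZVec v
          rest j = quot (expands sp j)

          split : ∀ j → x j ≡ linComb c₀ z j +
            (linComb c₁ X₁.new j + (linComb c₂ X₂.new j + linComb c₃ ones j)) + P * rest j
          split j = trans (eq (expands sp j)) (cong (λ t → t + P * rest j) (trans (ℤV.linComb-++ c z N₁ j)
            (cong (λ t → linComb c₀ z j + t) (trans (ℤV.linComb-++ (λ i → c (e₀ ↑ʳ i)) X₁.new N₂ j)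
            (cong (λ t → linComb c₁ X₁.new j + t) (ℤV.linComb-++ (λ i → c (e₀ ↑ʳ (a ↑ʳ i))) X₂.new ones j))))))

          T-ones : ∀ j → T (linComb c₃ ones) j ≡ + 0
          T-ones j = trans (T-linComb c₃ ones j)
            (ℤV.∑-zero (λ i → trans (cong (c₃ i *_) (T𝟙 j)) (ℤₚ.*-zeroʳ (c₃ i))))

          expanded₁ : ∀ j → T (linComb c₁ X₁.new) j ≡ linComb (λ i → P * c₁ i) Y₁ j
          expanded₁ j = trans (T-X₁ c₁ j) (sym (ℤV.linComb-*ˡ P c₁ Y₁ j))

          expanded₂ : ∀ j → T (linComb c₂ X₂.new) j ≡ linComb (λ i → P * (P * c₂ i)) Y₂ j
          expanded₂ j = trans (T-X₂ c₂ j)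
            (sym (trans (ℤV.linComb-*ˡ P (λ i → P * c₂ i) Y₂ j) (cong (P *_) (ℤV.linComb-*ˡ P c₂ Y₂ j))))

          expanded : ∀ j → T x j ≡ comb c₀ (λ i → P * c₁ i) (λ i → P * (P * c₂ i)) j + P * T rest j
          expanded j = trans (T-cong split j)
            (trans (T-sum₄ (linComb c₀ z) (linComb c₁ X₁.new) (linComb c₂ X₂.new) (linComb c₃ ones) rest j)
            (sum₄ (P * T rest j) (T-linComb c₀ z j) (expanded₁ j) (expanded₂ j) (T-ones j)))

      T-expand² : ∀ x → TExpansion x (P * P)
      T-expand² x = expansion (λ i → E₁.c₀ i + P * E₂.c₀ i) (λ i → E₁.c₁ i + P * E₂.c₁ i)
        (λ i → E₁.c₂ i + P * E₂.c₂ i)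
          (λ i → proj₁ (E₁.P∣c₁ i) + E₂.c₁ i , trans (cong (_+ P * E₂.c₁ i) (proj₂ (E₁.P∣c₁ i)))
            (sym (ℤₚ.*-distribˡ-+ P _ _)))
          (λ i → proj₁ (E₁.P²∣c₂ i) + P * proj₁ (E₂.P²∣c₂ i) ,
                 trans (cong₂ (λ s t → s + P * t) (proj₂ (E₁.P²∣c₂ i)) (proj₂ (E₂.P²∣c₂ i)))
                   (lem₂ P (proj₁ (E₁.P²∣c₂ i)) (proj₁ (E₂.P²∣c₂ i))))
          E₂.rest λ j →
          trans (E₁.T-expands j) (trans (cong (λ t → comb E₁.c₀ E₁.c₁ E₁.c₂ j + P * t) (E₂.T-expands j))
            (trans (lem (comb E₁.c₀ E₁.c₁ E₁.c₂ j) P (comb E₂.c₀ E₂.c₁ E₂.c₂ j) (T E₂.rest j))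
              (cong (λ t → t + P * P * T E₂.rest j) (sym (comb-+P E₁.c₀ E₁.c₁ E₁.c₂ E₂.c₀ E₂.c₁ E₂.c₂ j)))))
        where
        module E₁ = TExpansion (T-expand x)
        module E₂ = TExpansion (T-expand E₁.rest)
        lem : ∀ a P b r → a + P * (b + P * r) ≡ a + P * b + P * P * r
        lem = solve-∀
        lem₂ : ∀ P x y → P * (P * x) + P * (P * (P * y)) ≡ P * (P * (x + P * y))
        lem₂ = solve-∀

      -- The isomorphism onto the p-primary part of the cokernel.

      Im : ZVec v → Set
      Im = LinZ.ColumnSpace L

      im-resp : ∀ {x y} → (∀ j → x j ≡ y j) → Im x → Im y
      im-resp x≡y (t , x≡) = t , λ j → trans (sym (x≡y j)) (x≡ j)

      im-+ : ∀ {x y} → Im x → Im y → Im (λ j → x j + y j)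
      im-+ (t , x≡) (t′ , y≡) = (λ j → t j + t′ j) , λ j → trans (cong₂ _+_ (x≡ j) (y≡ j)) (sym (T-+ t t′ j))

      im-* : ∀ m {x} → Im x → Im (λ j → m * x j)
      im-* m (t , x≡) = (λ j → m * t j) , λ j → trans (cong (m *_) (x≡ j)) (sym (T-* m t j))

      -- A combination of `u` and p equals 1, so a class killed by both is zero.
      im-P-u : ∀ {y : ZVec v} → Im (λ j → u * y j) → Im (λ j → P * y j) → Im y
      im-P-u {y} uy Py = im-resp (λ j → trans (lem u⁻¹ u (y j) (quot inv) P)
          (trans (cong (λ t → (t + - (P * quot inv)) * y j) (eq inv)) (lem′ P (quot inv) (y j))))
          (im-+ (im-* u⁻¹ uy) (im-* (- quot inv) Py))
        where
        u⁻¹ = proj₁ (inverse-mod pp u≉0)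
        inv = proj₂ (inverse-mod pp u≉0)
        lem : ∀ a u y q P → a * (u * y) + - q * (P * y) ≡ (a * u + - (P * q)) * y
        lem = solve-∀
        lem′ : ∀ P q y → (+ 1 + P * q + - (P * q)) * y ≡ y
        lem′ = solve-∀

      -- Factors p are removed one at a time, applying the induction to p `y`; an inverse of `u` mod
      -- p is then enough.
      im-P^-u : ∀ k {y : ZVec v} → Im (λ j → u * y j) → Im (λ j → + (p ℕ.^ k) * y j) → Im y
      im-P^-u zero {y} uy y∈ = im-resp (λ j → ℤₚ.*-identityˡ (y j)) y∈
      im-P^-u (suc k) {y} uy y∈ = im-P-u uy (im-P^-u k
        (im-resp (λ j → lem P u (y j)) (im-* P uy))
        (im-resp (λ j → trans (cong (_* y j) (trans (ℤₚ.pos-* p (p ℕ.^ k)) (ℤₚ.*-comm P (+ (p ℕ.^ k)))))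
          (ℤₚ.*-assoc (+ (p ℕ.^ k)) P (y j))) y∈))
        where
        lem : ∀ P u y → P * (u * y) ≡ u * (P * y)
        lem = solve-∀

      im-P²u : ∀ y → ∑ y ≡ + 0 → Im (λ j → u * (P * P * y j))
      im-P²u y ∑y≡0 = (λ j → P * τ * y j + - + 1 * T y j) , λ j → sym
        (trans (T-+ (λ j → P * τ * y j) (λ j → - + 1 * T y j) j)
        (trans (cong₂ _+_ (T-* (P * τ) y j)
          (trans (T-* (- + 1) (T y) j)
          (cong (- + 1 *_) (trans (quadratic y j)
          (cong (λ s → P * τ * T y j - P * (P * u) * y j + μ * s) ∑y≡0)))))
          (lem P τ (T y j) u (y j) μ)))
        where
        lem : ∀ P τ t u y μ → P * τ * t + - + 1 * (P * τ * t - P * (P * u) * y + μ * + 0) ≡ u * (P * P * y)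
        lem = solve-∀

      im-P²-comb : ∀ c₀ c₁ c₂ → Im (λ j → P * P * comb c₀ c₁ c₂ j)
      im-P²-comb c₀ c₁ c₂ = im-resp (λ j → lem P (linComb c₀ Y₀ j) (linComb c₁ Y₁ j) (linComb c₂ Y₂ j))
        (im-+ (im-+ (im-* (P * P) (linComb c₀ z , λ j → sym (T-linComb c₀ z j)))
                    (im-* P (linComb c₁ X₁.new , λ j → sym (T-X₁ c₁ j))))
              (linComb c₂ X₂.new , λ j → sym (T-X₂ c₂ j)))
        where
        lem : ∀ P x y z → P * P * x + P * (P * y) + P * (P * z) ≡ P * P * (x + y + z)
        lem = solve-∀

      -- In the cokernel `Y₀` vanishes, p kills `Y₁` and p² kills `Y₂`, so the classes of `Y₁` and
      -- `Y₂` are the expected generators.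
      φ : Target a b → ZVec v
      φ (xs , ys) j = linComb xs Y₁ j + linComb ys Y₂ j

      pp≡ : + (p ℕ.* p) ≡ P * P
      pp≡ = ℤₚ.pos-* p p

      p^2≡ : + (p ℕ.^ 2) ≡ P * P
      p^2≡ = trans (cong (λ t → + (p ℕ.* t)) (ℕₚ.*-identityʳ p)) pp≡

      φ-torsion : ∀ t → Im (scale (+ (p ℕ.^ 2)) (φ t))
      φ-torsion (xs , ys) = im-resp
        (λ j → trans (lem P (linComb xs Y₁ j) (linComb ys Y₂ j)) (cong (_* φ (xs , ys) j) (sym p^2≡)))
        (im-+ (im-* P (linComb xs X₁.new , λ j → sym (T-X₁ xs j))) (linComb ys X₂.new , λ j → sym (T-X₂ ys j)))
        where
        lem : ∀ P x y → P * (P * x) + P * (P * y) ≡ P * P * (x + y)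
        lem = solve-∀

      linComb-affine : ∀ {m} (y : Family m v) {c : Fin m → ℤ} d q k → (∀ i → c i ≡ d i + k * q i) →
                       ∀ j → linComb c y j ≡ linComb d y j + k * linComb q y j
      linComb-affine y {c} d q k c≡ j = trans (ℤV.linComb-congˡ y c≡ j)
        (trans (ℤV.linComb-+ d (λ i → k * q i) y j)
        (cong (λ t → linComb d y j + t) (ℤV.linComb-*ˡ k q y j)))

      φ-cong : ∀ t t′ → t ≈T[ p ] t′ → Im (subV (φ t) (φ t′))
      φ-cong (xs , ys) (xs′ , ys′) (xs≈ , ys≈) = im-resp
        (λ j → trans (lem P (linComb xs′ Y₁ j) (linComb ys′ Y₂ j) (linComb q₁ Y₁ j) (linComb q₂ Y₂ j))
          (cong₂ (λ s t → s + t - φ (xs′ , ys′) j) (sym (linComb-affine Y₁ xs′ q₁ P (λ i → eq (m₁ i)) j))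
            (sym (linComb-affine Y₂ ys′ q₂ (P * P)
              (λ i → trans (eq (m₂ i)) (cong (λ t → ys′ i + t * q₂ i) pp≡)) j))))
          (im-+ (linComb q₁ X₁.new , λ j → sym (T-X₁ q₁ j)) (linComb q₂ X₂.new , λ j → sym (T-X₂ q₂ j)))
        where
        m₁ : ∀ i → xs i ≈ xs′ i [mod P ]
        m₁ i = ∣⇒≈ (xs≈ i)
        m₂ : ∀ i → ys i ≈ ys′ i [mod + (p ℕ.* p) ]
        m₂ i = ∣⇒≈ (ys≈ i)
        q₁ : Fin a → ℤ
        q₁ i = quot (m₁ i)
        q₂ : Fin b → ℤ
        q₂ i = quot (m₂ i)
        lem : ∀ P x y q r → P * q + P * (P * r) ≡ x + P * q + (y + P * P * r) - (x + y)
        lem = solve-∀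

      φ-homo : ∀ t t′ → Im (subV (φ (addT t t′)) (addV (φ t) (φ t′)))
      φ-homo (xs , ys) (xs′ , ys′) = im-resp
        (λ j → trans (lem (linComb xs Y₁ j) (linComb xs′ Y₁ j) (linComb ys Y₂ j) (linComb ys′ Y₂ j) (T 𝟙 j))
          (cong₂ (λ s t → s + t - (φ (xs , ys) j + φ (xs′ , ys′) j)) (sym (ℤV.linComb-+ xs xs′ Y₁ j))
            (sym (ℤV.linComb-+ ys ys′ Y₂ j))))
          -- The difference is the zero vector, shown to be an image as 0 times T 𝟙.
          (im-* (+ 0) (𝟙 , λ j → refl))
        where
        lem : ∀ x x′ y y′ t → + 0 * t ≡ x + x′ + (y + y′) - (x + y + (x′ + y′))
        lem = solve-∀

      -- If φ t - φ t′ = T x, subtracting the expansion of `T x` to precision p² leaves a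
      -- combination of `Y` divisible by p². Its coefficients are then divisible by p², so the
      -- differences of coordinates agree mod p² with `E.c₁`, a multiple of p, and with `E.c₂`, a
      -- multiple of p².
      φ-injective : ∀ t t′ → Im (subV (φ t) (φ t′)) → t ≈T[ p ] t′
      φ-injective (xs , ys) (xs′ , ys′) (x , φ≡) =
          (λ i → ≈⇒∣ {P} {xs i} {xs′ i} (mod (proj₁ (E.P∣c₁ i) + P * proj₁ (proj₁ divisible i))
             (trans (lem₁ (xs i) (xs′ i) (E.c₁ i))
               (trans (cong₂ (λ s t → xs′ i + s + t) (proj₂ (E.P∣c₁ i)) (proj₂ (proj₁ divisible i)))
               (lem₂ P (xs′ i) (proj₁ (E.P∣c₁ i)) (proj₁ (proj₁ divisible i))))))) ,
          (λ i → ≈⇒∣ {+ (p ℕ.* p)} {ys i} {ys′ i} (mod (proj₁ (E.P²∣c₂ i) + proj₁ (proj₂ divisible i))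
             (trans (lem₁ (ys i) (ys′ i) (E.c₂ i))
               (trans (cong₂ (λ s t → ys′ i + s + t) (proj₂ (E.P²∣c₂ i)) (proj₂ (proj₂ divisible i)))
               (trans (lem₃ P (ys′ i) (proj₁ (E.P²∣c₂ i)) (proj₁ (proj₂ divisible i)))
                 (cong (λ t → ys′ i + t * (proj₁ (E.P²∣c₂ i) + proj₁ (proj₂ divisible i))) (sym pp≡)))))))
        where
        module E = TExpansion (T-expand² x)
        lem₁ : ∀ x y c → x ≡ y + c + (x + - + 1 * y + - + 1 * c)
        lem₁ = solve-∀
        lem₂ : ∀ P x q r → x + P * q + P * (P * r) ≡ x + P * (q + P * r)
        lem₂ = solve-∀
        lem₃ : ∀ P x q r → x + P * (P * q) + P * (P * r) ≡ x + P * P * (q + r)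
        lem₃ = solve-∀

        minus : ∀ {m} (y : Family m v) (c c′ d : Fin m → ℤ) j →
                linComb (λ i → c i + - + 1 * c′ i + - + 1 * d i) y j ≡ linComb c y j + - + 1 * linComb c′ y j + - + 1 * linComb d y j
        minus y c c′ d j = trans (linComb-affine y (λ i → c i + - + 1 * c′ i) d (- + 1) (λ i → refl) j)
          (cong (_+ - + 1 * linComb d y j) (linComb-affine y c c′ (- + 1) (λ i → refl) j))

        divisible = Y-independent² (λ i → - + 1 * E.c₀ i) (λ i → xs i + - + 1 * xs′ i + - + 1 * E.c₁ i)
          (λ i → ys i + - + 1 * ys′ i + - + 1 * E.c₂ i) (T E.rest)
          λ j → trans (cong₂ _+_ (cong₂ _+_ (ℤV.linComb-*ˡ (- + 1) E.c₀ Y₀ j) (minus Y₁ xs xs′ E.c₁ j))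
            (minus Y₂ ys ys′ E.c₂ j))
            (trans (lem₄ (linComb xs Y₁ j) (linComb ys Y₂ j) (linComb xs′ Y₁ j) (linComb ys′ Y₂ j)
              (linComb E.c₀ Y₀ j) (linComb E.c₁ Y₁ j) (linComb E.c₂ Y₂ j))
            (trans (cong (λ t → t - comb E.c₀ E.c₁ E.c₂ j) (trans (φ≡ j) (E.T-expands j)))
              (lem₅ (comb E.c₀ E.c₁ E.c₂ j) P (T E.rest j))))
          where
          lem₄ : ∀ x y x′ y′ c₀ c₁ c₂ → - + 1 * c₀ + (x + - + 1 * x′ + - + 1 * c₁) +
            (y + - + 1 * y′ + - + 1 * c₂) ≡ (x + y - (x′ + y′)) - (c₀ + c₁ + c₂)
          lem₄ = solve-∀
          lem₅ : ∀ c P t → c + P * P * t - c ≡ P * (P * t)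
          lem₅ = solve-∀

      -- A torsion class has sum zero and can be expanded to precision p²; its `Y₀`-part is an
      -- image. The remainder p² `rest` is an image after multiplication by `u`, and also after
      -- multiplication by a power of p, hence it is one itself.
      φ-surjective : ∀ x → (Σ ℕ λ k → Im (scale (+ (p ℕ.^ k)) x)) → Σ (Target a b) λ t → Im (subV (φ t) x)
      φ-surjective x (k , t , x≡) = (E.c₁ , E.c₂) , im-resp
          (λ j → trans (lem₀ (linComb E.c₀ Y₀ j) (linComb E.c₁ Y₁ j) (linComb E.c₂ Y₂ j) (P * P * E.rest j))
            (cong (λ t → φ (E.c₁ , E.c₂) j - t) (sym (E.expands j))))
          (im-+ (im-* (- + 1) (linComb E.c₀ z , λ j → sym (T-linComb E.c₀ z j))) (im-* (- + 1) rest∈))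
        where
        instance
          p^k≢0 : ℕ.NonZero (p ℕ.^ k)
          p^k≢0 = ℕₚ.m^n≢0 p k {{prime⇒nonZero pp}}

        ∑x≡0 : ∑ x ≡ + 0
        ∑x≡0 = ℤₚ.*-cancelˡ-≡ (+ (p ℕ.^ k)) (∑ x) (+ 0)
          (trans (sym (ℤV.∑-*ˡ (+ (p ℕ.^ k)) x))
          (trans (ℤV.∑-cong x≡) (trans (∑T t) (sym (ℤₚ.*-zeroʳ (+ (p ℕ.^ k)))))))

        module E = Expansion (Y-expand² x ∑x≡0)

        lem₀ : ∀ x y z r → - + 1 * x + - + 1 * r ≡ y + z - (x + y + z + r)
        lem₀ = solve-∀

        rest∈ : Im (λ j → P * P * E.rest j)
        -- The exponent `k` makes `x` an image, and the extra 2 does the same for the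
        -- `Y`-combination subtracted from it.
        rest∈ = im-P^-u (2 ℕ.+ k) (im-P²u E.rest E.∑rest) (im-resp
          (λ j → trans (cong (λ t → P * P * (+ (p ℕ.^ k) * t) + - + (p ℕ.^ k) * (P * P * comb E.c₀ E.c₁ E.c₂ j))
            (E.expands j))
            (trans (lem P (+ (p ℕ.^ k)) (comb E.c₀ E.c₁ E.c₂ j) (E.rest j))
              (cong (_* (P * P * E.rest j)) (sym pow))))
          (im-+ (im-* (P * P) (t , x≡)) (im-* (- + (p ℕ.^ k)) (im-P²-comb E.c₀ E.c₁ E.c₂))))
          where
          pow : + (p ℕ.^ (2 ℕ.+ k)) ≡ P * P * + (p ℕ.^ k)
          pow = trans (ℤₚ.pos-* p (p ℕ.* p ℕ.^ k))
            (trans (cong (P *_) (ℤₚ.pos-* p (p ℕ.^ k))) (sym (ℤₚ.*-assoc P P (+ (p ℕ.^ k)))))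
          lem : ∀ P k c r → P * P * (k * (c + P * P * r)) + - k * (P * P * c) ≡ P * P * k * (P * P * r)
          lem = solve-∀

open IntegralLattice

-- Rational eigenspaces and their dimensions.

module RationalSpectrum where
  open import Data.Rational using (_+_; _*_; -_; _-_)
  open ≡ using (refl; sym; trans; cong; cong₂)
  open Data.Rational.Solver.+-*-Solver using (solve; _:+_; _:*_; :-_; _:=_)

  ℚ-field : DiscreteField
  ℚ-field = record
    { commutativeRing = ℚₚ.+-*-commutativeRing
    ; _≈?_ = ℚₚ._≟_
    ; inverse = λ {x} x≢0 → let instance _ = ℚ.≢-nonZero x≢0 in ℚ.1/ x , ℚₚ.*-inverseˡ x
    ; 1≉0 = λ ()
    }

  module Embedding where

    ι : ℤ → ℚ
    ι a = a ℚ./ 1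

    toℚᵘ-ι : ∀ a → toℚᵘ (ι a) ℚᵘ.≃ mkℚᵘ a 0
    toℚᵘ-ι a = ℚₚ.toℚᵘ-fromℚᵘ (mkℚᵘ a 0)

    ι-+ : ∀ a b → ι (a ℤ.+ b) ≡ ι a + ι b
    ι-+ a b = ℚₚ.toℚᵘ-injective (ℚᵘₚ.≃-trans (toℚᵘ-ι (a ℤ.+ b)) (ℚᵘₚ.≃-trans (*≡* (lem a b))
      (ℚᵘₚ.≃-sym (ℚᵘₚ.≃-trans (ℚₚ.toℚᵘ-homo-+ (ι a) (ι b)) (ℚᵘₚ.+-cong (toℚᵘ-ι a) (toℚᵘ-ι b))))))
      where
      lem : ∀ a b → (a ℤ.+ b) ℤ.* + 1 ≡ (a ℤ.* + 1 ℤ.+ b ℤ.* + 1) ℤ.* + 1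
      lem = solve-∀

    ι-* : ∀ a b → ι (a ℤ.* b) ≡ ι a * ι b
    ι-* a b = ℚₚ.toℚᵘ-injective (ℚᵘₚ.≃-trans (toℚᵘ-ι (a ℤ.* b))
      (ℚᵘₚ.≃-sym (ℚᵘₚ.≃-trans (ℚₚ.toℚᵘ-homo-* (ι a) (ι b)) (ℚᵘₚ.*-cong (toℚᵘ-ι a) (toℚᵘ-ι b)))))

    ι-injective : ∀ {a b} → ι a ≡ ι b → a ≡ b
    ι-injective {a} {b} e with ℚᵘₚ.≃-trans (ℚᵘₚ.≃-sym (toℚᵘ-ι a))
      (ℚᵘₚ.≃-trans (ℚᵘₚ.≃-reflexive (cong toℚᵘ e)) (toℚᵘ-ι b))
    ... | *≡* e′ = trans (sym (ℤₚ.*-identityʳ a)) (trans e′ (ℤₚ.*-identityʳ b))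

    ι-neg : ∀ a → ι (ℤ.- a) ≡ - ι a
    ι-neg a = trans (sym (ℚₚ.+-identityʳ _)) (trans (cong (λ t → ι (ℤ.- a) + t) (sym (ℚₚ.+-inverseʳ (ι a))))
      (trans (sym (ℚₚ.+-assoc (ι (ℤ.- a)) (ι a) (- ι a)))
        (trans (cong (_+ - ι a) (trans (sym (ι-+ (ℤ.- a) a)) (cong ι (ℤₚ.+-inverseˡ a)))) (ℚₚ.+-identityˡ _))))

    ι-∑ : ∀ {n} (f : Fin n → ℤ) → ι (sumF (+ 0) ℤ._+_ f) ≡ sumF 0ℚ _+_ (ι ∘ f)
    ι-∑ {zero} f = refl
    ι-∑ {suc n} f = trans (ι-+ (f zero) (sumF (+ 0) ℤ._+_ (f ∘ suc)))
      (cong (λ t → ι (f zero) + t) (ι-∑ (f ∘ suc)))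
  open Embedding

  module ℚV = LinearAlgebra ℚ-field
  open ℚV using (∑; δ; linComb; mulMV; Span; Family; Independent)

  module Spectrum
    {n : ℕ} (M : Fin n → Fin n → ℚ) (τ κ μ : ℚ)
    (square : ∀ i j → ∑ (λ l → M i l * M l j) ≡ τ * M i j + (κ * δ i j + μ))
    (M-sym : ∀ i j → M i j ≡ M j i) (rows : ∀ i → ∑ (M i) ≡ 0ℚ)
    where

    T : (Fin n → ℚ) → Fin n → ℚ
    T = mulMV M

    quadratic : ∀ x i → T (T x) i ≡ τ * T x i + (κ * x i + μ * ∑ x)
    quadratic = ℚV.mulMV-square M τ κ μ square

    ∑T : ∀ x → ∑ (T x) ≡ 0ℚ
    ∑T = ℚV.∑-mulMV M M-sym rows

    Eigenvector : ℚ → (Fin n → ℚ) → Set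
    Eigenvector r x = ∀ i → T x i ≡ r * x i

    shifted : ℚ → Fin n → Fin n → ℚ
    shifted r i j = M i j - (if does (i ≟ᶠ j) then r else 0ℚ)

    mulMV-shifted : ∀ r x i → mulMV (shifted r) x i ≡ T x i + - r * x i
    mulMV-shifted r x i = trans (ℚV.∑-cong (λ j → term (M i j) (x j) (does (i ≟ᶠ j))))
      (trans (ℚV.∑-+ (λ j → M i j * x j) (λ j → - r * (δ i j * x j)))
        (cong (λ t → T x i + t) (trans (ℚV.∑-*ˡ (- r) (λ j → δ i j * x j)) (cong (- r *_) (ℚV.∑-δ i x)))))
      where
      term : ∀ m x (b : Bool) → (m - (if b then r else 0ℚ)) * x ≡ m * x + - r * ((if b then 1ℚ else 0ℚ) * x)
      term m x true = trans (solve 3 (λ m r x → (m :+ :- r) :* x := m :* x :+ :- r :* x) refl m r x)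
        (cong (λ t → m * x + - r * t) (sym (ℚₚ.*-identityˡ x)))
      term m x false = trans (cong (_* x) (ℚₚ.+-identityʳ m)) (trans (sym (ℚₚ.+-identityʳ (m * x)))
        (cong (λ t → m * x + t) (sym (trans (cong (- r *_) (ℚₚ.*-zeroˡ x)) (ℚₚ.*-zeroʳ (- r))))))

    kernel⇒eigenvector : ∀ {r x} → ℚV.Kernel (shifted r) x → Eigenvector r x
    kernel⇒eigenvector {r} {x} h i = trans
      (solve 3 (λ t r y → t := t :+ :- r :* y :+ r :* y) refl (T x i) r (x i))
      (trans (cong (_+ r * x i) (trans (sym (mulMV-shifted r x i)) (h i))) (ℚₚ.+-identityˡ (r * x i)))

    eigenvector⇒kernel : ∀ {r x} → Eigenvector r x → ℚV.Kernel (shifted r) x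
    eigenvector⇒kernel {r} {x} h i = trans (mulMV-shifted r x i) (trans (cong (_+ - r * x i) (h i))
      (trans (sym (ℚₚ.*-distribʳ-+ (x i) r (- r)))
        (trans (cong (_* x i) (ℚₚ.+-inverseʳ r)) (ℚₚ.*-zeroˡ (x i)))))

    eigenvector-linComb : ∀ {m r} {w : Family m n} → (∀ i → Eigenvector r (w i)) → ∀ c → Eigenvector r
      (linComb c w)
    eigenvector-linComb {r = r} {w} h c i = trans (ℚV.mulMV-linComb M c w i)
      (trans (ℚV.linComb-congʳ c h i) (ℚV.linComb-*ʳ r c w i))

    eigenvector-∑ : ∀ {r x} → r ≢ 0ℚ → Eigenvector r x → ∑ x ≡ 0ℚ
    eigenvector-∑ {r} {x} r≢0 h = ℚV.cancel-unit r≢0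
      (trans (sym (ℚV.∑-*ˡ r x)) (trans (sym (ℚV.∑-cong h)) (∑T x)))

    T-eigenvector : ∀ {r x} → Eigenvector r x → ∀ i → T (T x) i ≡ r * (r * x i)
    T-eigenvector {r} {x} h i = trans (ℚV.mulMV-cong M h i) (trans (ℚV.mulMV-* M r x i) (cong (r *_) (h i)))

    nonzero-eigenvector : ∀ {r f} → ℚV.HasDim (ℚV.Kernel (shifted r)) (suc f) →
                          Σ (Fin n → ℚ) λ x → Eigenvector r x × ∃ λ i → x i ≢ 0ℚ
    nonzero-eigenvector {r} {f} ((w , w∈ , ind) , _) with any? (λ i → ¬? (w zero i ℚₚ.≟ 0ℚ))
    ... | yes (i , wi≢0) = w zero , kernel⇒eigenvector {r} (w∈ zero) , i , wi≢0
    ... | no none = ⊥-elim (DiscreteField.1≉0 ℚ-field (ind (1ℚ ∷ λ _ → 0ℚ)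
        (λ j → trans (cong₂ _+_
          (trans (ℚₚ.*-identityˡ (w zero j)) (decidable-stable (w zero j ℚₚ.≟ 0ℚ) (λ h → none (j , h))))
                                (ℚV.linComb-zero (w ∘ suc) (λ _ → refl) j)) refl) zero))

    -- An eigenvector for a nonzero eigenvalue has sum zero, so the `μ`-term drops out of the
    -- quadratic relation; a nonzero coordinate can then be cancelled.
    characteristic : ∀ {r f} → r ≢ 0ℚ → ℚV.HasDim (ℚV.Kernel (shifted r)) (suc f) → r * r ≡ τ * r + κ
    characteristic {r} r≢0 dim = trans (solve 2 (λ a b → a := a :+ :- b :+ b) refl (r * r) (τ * r + κ))
      (trans (cong (_+ (τ * r + κ)) (ℚV.cancel-unit xi≢0 zero-product)) (ℚₚ.+-identityˡ _))
      where
      vec = nonzero-eigenvector {r} dim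
      x = proj₁ vec
      h = proj₁ (proj₂ vec)
      i = proj₁ (proj₂ (proj₂ vec))
      xi≢0 = proj₂ (proj₂ (proj₂ vec))
      rhs : T (T x) i ≡ τ * (r * x i) + (κ * x i + 0ℚ)
      rhs = trans (quadratic x i)
        (cong₂ (λ s t → τ * s + (κ * x i + t)) (h i) (trans (cong (μ *_) (eigenvector-∑ r≢0 h)) (ℚₚ.*-zeroʳ μ)))
      zero-product : x i * (r * r + - (τ * r + κ)) ≡ 0ℚ
      zero-product = trans (solve 4
        (λ x r τ κ → x :* (r :* r :+ :- (τ :* r :+ κ)) := r :* (r :* x) :+ :- (τ :* (r :* x) :+ κ :* x)) refl
        (x i) r τ κ)
        (trans (cong₂ (λ s t → s + - (τ * (r * x i) + t)) (sym (T-eigenvector {r} {x} h i))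
          (sym (ℚₚ.+-identityʳ (κ * x i))))
          (trans (cong (λ s → s + - (τ * (r * x i) + (κ * x i + 0ℚ))) rhs)
            (ℚₚ.+-inverseʳ (τ * (r * x i) + (κ * x i + 0ℚ)))))

    module Multiplicities {r s : ℚ} {f g : ℕ} (r≢0 : r ≢ 0ℚ) (s≢0 : s ≢ 0ℚ) (r≢s : r ≢ s)
      (τ≡ : τ ≡ r + s) (κ≡ : κ ≡ - (r * s)) (zero-index : Fin n)
      (dim-r : ℚV.HasDim (ℚV.Kernel (shifted r)) f) (dim-s : ℚV.HasDim (ℚV.Kernel (shifted s)) g) where

      ρ : Family f n
      ρ = proj₁ (proj₁ dim-r)
      σ : Family g n
      σ = proj₁ (proj₁ dim-s)
      ones : Family 1 n
      ones _ _ = 1ℚ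

      basis : Family (f ℕ.+ (g ℕ.+ 1)) n
      basis = ρ ++ (σ ++ ones)

      d = r + - s

      d≢0 : d ≢ 0ℚ
      d≢0 d≡0 = r≢s (trans (solve 2 (λ a b → a := a :+ :- b :+ b) refl r s)
        (trans (cong (_+ s) d≡0) (ℚₚ.+-identityˡ s)))

      T-ones : ∀ c i → T (linComb c ones) i ≡ 0ℚ
      T-ones c i = trans (ℚV.mulMV-linComb M c ones i) (ℚV.∑-zero (λ k → trans (cong (c k *_)
        (trans (ℚV.∑-cong (λ j → ℚₚ.*-identityʳ (M i j))) (rows i))) (ℚₚ.*-zeroʳ (c k))))

      -- Applying `T` once and twice removes `w` and gives r x + s y = 0 and r² x + s² y = 0.
      -- Eliminating `y` leaves r (r - s) x = 0.
      split-eigenvectors : ∀ x y w → Eigenvector r x → Eigenvector s y → (∀ i → T w i ≡ 0ℚ) →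
                           (∀ i → x i + (y i + w i) ≡ 0ℚ) → (∀ i → x i ≡ 0ℚ) × (∀ i → y i ≡ 0ℚ)
      split-eigenvectors x y w hx hy hw sum≡0 = x≡0 , λ i → ℚV.cancel-unit s≢0
        (trans (sym (ℚₚ.+-identityˡ (s * y i)))
          (trans (cong (_+ s * y i) (sym (trans (cong (r *_) (x≡0 i)) (ℚₚ.*-zeroʳ r)))) (once i)))
        where
        T-zero : ∀ {x} → (∀ i → x i ≡ 0ℚ) → ∀ i → T x i ≡ 0ℚ
        T-zero h i = ℚV.∑-zero (λ j → trans (cong (M i j *_) (h j)) (ℚₚ.*-zeroʳ (M i j)))
        once : ∀ i → r * x i + s * y i ≡ 0ℚ
        once i = trans (cong₂ _+_ (sym (hx i))
          (trans (sym (ℚₚ.+-identityʳ (s * y i))) (cong₂ _+_ (sym (hy i)) (sym (hw i)))))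
          (trans (cong (λ t → T x i + t) (sym (ℚV.mulMV-+ M y w i)))
            (trans (sym (ℚV.mulMV-+ M x (λ i → y i + w i) i)) (T-zero sum≡0 i)))
        twice : ∀ i → r * (r * x i) + s * (s * y i) ≡ 0ℚ
        twice i = trans (cong₂ _+_ (sym (trans (ℚV.mulMV-* M r x i) (cong (r *_) (hx i))))
          (sym (trans (ℚV.mulMV-* M s y i) (cong (s *_) (hy i)))))
          (trans (sym (ℚV.mulMV-+ M (λ i → r * x i) (λ i → s * y i) i)) (T-zero once i))
        x≡0 : ∀ i → x i ≡ 0ℚ
        x≡0 i = ℚV.cancel-unit d≢0 (ℚV.cancel-unit r≢0 (trans
          (solve 4 (λ r s x y → r :* ((r :+ :- s) :* x) := r :* (r :* x) :+ s :* (s :* y) :+ :-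
            (s :* (r :* x :+ s :* y))) refl r s (x i) (y i))
          (trans (cong₂ (λ a b → a + - (s * b)) (twice i) (once i)) (cong (λ t → 0ℚ + - t) (ℚₚ.*-zeroʳ s)))))

      basis-independent : Independent basis
      basis-independent = ℚV.++-independent {u = ρ} {w = σ ++ ones} λ c e h →
        let e₁ = λ i → e (i ↑ˡ 1)
            e₂ = λ i → e (g ↑ʳ i)
            sum≡0 = λ i → trans (cong (λ t → linComb c ρ i + t) (sym (ℚV.linComb-++ e σ ones i))) (h i)
            parts = split-eigenvectors (linComb c ρ) (linComb e₁ σ) (linComb e₂ ones)
                      (eigenvector-linComb {r = r}
                        (λ i → kernel⇒eigenvector {r} (proj₁ (proj₂ (proj₁ dim-r)) i)) c)
                      (eigenvector-linComb {r = s}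
                        (λ i → kernel⇒eigenvector {s} (proj₁ (proj₂ (proj₁ dim-s)) i)) e₁)
                      (T-ones e₂) sum≡0
            c≡0 = proj₂ (proj₂ (proj₁ dim-r)) c (proj₁ parts)
            tail≡0 = λ i → trans (sym (ℚₚ.+-identityˡ _))
                       (trans (cong (_+ linComb e (σ ++ ones) i) (sym (proj₁ parts i))) (h i))
        in c≡0 , ℚV.++-independent {u = σ} {w = ones} σ-ones e tail≡0
        where
        σ-ones : ∀ e₁ e₂ → (∀ j → linComb e₁ σ j + linComb e₂ ones j ≡ 0ℚ) → (∀ i → e₁ i ≡ 0ℚ) ×
          (∀ i → e₂ i ≡ 0ℚ)
        σ-ones e₁ e₂ h = proj₂ (proj₂ (proj₁ dim-s)) e₁ (proj₂ parts) ,
          -- The coefficient of the all-one vector is read off at one coordinate, which `zero-index`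
          -- provides.
          λ { zero → trans (trans (sym (ℚₚ.*-identityʳ (e₂ zero))) (sym (ℚₚ.+-identityʳ (e₂ zero * 1ℚ))))
              (trans (sym (ℚₚ.+-identityˡ _))
                (trans (cong (_+ linComb e₂ ones zero-index) (sym (proj₂ parts zero-index))) (h zero-index))) }
          where
          parts = split-eigenvectors (λ _ → 0ℚ) (linComb e₁ σ) (linComb e₂ ones)
            (λ i → trans (ℚV.∑-zero (λ j → ℚₚ.*-zeroʳ (M i j))) (sym (ℚₚ.*-zeroʳ r)))
            (eigenvector-linComb {r = s} (λ i → kernel⇒eigenvector {s} (proj₁ (proj₂ (proj₁ dim-s)) i)) e₁)
            (T-ones e₂) (λ i → trans (ℚₚ.+-identityˡ _) (h i))

      -- `T x` has sum zero, so (T - r)(T - s) kills it: the image of T (T - s) lies in the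
      -- eigenspace of r.
      projection-eigenvector : ∀ r s → τ ≡ r + s → κ ≡ - (r * s) → ∀ x → Eigenvector r
        (λ i → T (T x) i + - s * T x i)
      projection-eigenvector r s τ≡ κ≡ x i = trans (ℚV.mulMV-+ M (T (T x)) (λ i → - s * T x i) i)
        (trans (cong₂ _+_ (trans (quadratic (T x) i)
          (cong₂ _+_ (cong (_* T (T x) i) τ≡)
          (cong₂ _+_ (cong (_* T x i) κ≡) (trans (cong (μ *_) (∑T x)) (ℚₚ.*-zeroʳ μ)))))
                          (ℚV.mulMV-* M (- s) (T x) i))
        (trans (cong (λ t → (r + s) * T (T x) i + t + - s * T (T x) i) (ℚₚ.+-identityʳ (- (r * s) * T x i)))
          (solve 4 (λ r s a b → (r :+ s) :* a :+ :- (r :* s) :* b :+ :- s :* a := r :*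
            (a :+ :- s :* b)) refl r s (T (T x) i) (T x i))))

      -- Lagrange interpolation at the eigenvalues r, s and 0, multiplied by r s (r - s) to clear
      -- denominators. The component at 0 is a multiple of (T - r)(T - s) x = μ (∑ x) 𝟙.
      basis-spanning : ∀ x → Span basis x
      basis-spanning x = ℚV.span-unscale s≢0
        (ℚV.span-unscale r≢0 (ℚV.span-unscale d≢0 (ℚV.span-resp (λ i → sym (combine i))
        (ℚV.span-+ (ℚV.span-* s in-ρ) (ℚV.span-+ (ℚV.span-* (- r) in-σ) (ℚV.span-* (d * (μ * ∑ x)) in-ones))))))
        where
        in-ρ : Span basis (λ i → T (T x) i + - s * T x i)
        in-ρ = ℚV.span-++ˡ {u = ρ} {w = σ ++ ones} (ℚV.hasDim-spanning {S = ℚV.Kernel (shifted r)} dim-r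
          (eigenvector⇒kernel (projection-eigenvector r s τ≡ κ≡ x)))
        in-σ : Span basis (λ i → T (T x) i + - r * T x i)
        in-σ = ℚV.span-++ʳ {u = ρ} {w = σ ++ ones}
          (ℚV.span-++ˡ {u = σ} {w = ones} (ℚV.hasDim-spanning {S = ℚV.Kernel (shifted s)} dim-s
          (eigenvector⇒kernel (projection-eigenvector s r (trans τ≡ (ℚₚ.+-comm r s))
            (trans κ≡ (cong -_ (ℚₚ.*-comm r s))) x))))
        in-ones : Span basis (λ _ → 1ℚ)
        in-ones = ℚV.span-++ʳ {u = ρ} {w = σ ++ ones} (ℚV.span-++ʳ {u = σ} {w = ones} (ℚV.span-∈ zero))
        combine : ∀ i → d * (r * (s * x i)) ≡ s * (T (T x) i + - s * T x i) +
          (- r * (T (T x) i + - r * T x i) + d * (μ * ∑ x) * 1ℚ)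
        combine i = sym (trans
          (cong (λ t → s * (T (T x) i + - s * T x i) + (- r * (T (T x) i + - r * T x i) + t))
          (ℚₚ.*-identityʳ (d * (μ * ∑ x))))
          (trans (cong (λ t → s * (t + - s * T x i) + (- r * (t + - r * T x i) + d * (μ * ∑ x)))
            (trans (quadratic x i) (cong₂ _+_ (cong (_* T x i) τ≡) (cong (λ t → t * x i + μ * ∑ x) κ≡))))
          (solve 5 (λ r s a x m → s :* ((r :+ s) :* a :+ (:- (r :* s) :* x :+ m) :+ :- s :* a)
               :+ (:- r :* ((r :+ s) :* a :+ (:- (r :* s) :* x :+ m) :+ :- r :* a) :+ (r :+ :- s) :* m)
               := (r :+ :- s) :* (r :* (s :* x))) refl r s (T x i) (x i) (μ * ∑ x))))

      multiplicities : f ℕ.+ (g ℕ.+ 1) ≡ n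
      multiplicities = ℚV.basis-size {w = basis} basis-independent basis-spanning

open RationalSpectrum

-- The Laplacian of a strongly regular graph: quadratic relation, eigenvalues and the final count.

module StronglyRegular where
  open import Data.Integer using (-_; _+_; _*_; _-_)
  open ≡ using (refl; sym; trans; cong; cong₂)
  open ℤV using (∑; δ; mulMV)
  open Embedding

  module SRG {n : ℕ} {G : Graph (suc n)} {k λ′ μ : ℕ} (srg : IsSRG G k λ′ μ) where

    L : Fin (suc n) → Fin (suc n) → ℤ
    L = laplacian G k

    A : Fin (suc n) → Fin (suc n) → ℤ
    A i j = b2ℤ (G i j)

    A-sym : ∀ i j → A i j ≡ A j i
    A-sym i j = cong b2ℤ (proj₁ (proj₁ srg) i j)

    L≡ : ∀ i j → L i j ≡ + k * δ i j + - + 1 * A i j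
    L≡ i j = lem (does (i ≟ᶠ j)) (A i j)
      where
      lem : ∀ (b : Bool) a → (if b then + k else + 0) - a ≡ + k * (if b then + 1 else + 0) + - + 1 * a
      lem true  = lem₁ (+ k)
        where
        lem₁ : ∀ k a → k - a ≡ k * + 1 + - + 1 * a
        lem₁ = solve-∀
      lem false = lem₀ (+ k)
        where
        lem₀ : ∀ k a → + 0 - a ≡ k * + 0 + - + 1 * a
        lem₀ = solve-∀

    L-sym : ∀ i j → L i j ≡ L j i
    L-sym i j = trans (L≡ i j)
      (trans (cong₂ (λ s t → + k * s + - + 1 * t) (ℤV.δ-sym i j) (A-sym i j)) (sym (L≡ j i)))

    ∑-b2ℕ : ∀ {m} (f : Fin m → Bool) → ∑ (λ j → b2ℤ (f j)) ≡ + sumF 0 ℕ._+_ (λ j → b2ℕ (f j))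
    ∑-b2ℕ {zero} f = refl
    ∑-b2ℕ {suc m} f = cong₂ _+_ (b2ℤ≡ (f zero)) (∑-b2ℕ (f ∘ suc))
      where
      b2ℤ≡ : ∀ b → b2ℤ b ≡ + b2ℕ b
      b2ℤ≡ true = refl
      b2ℤ≡ false = refl

    ∑-b2ℕ² : ∀ {m} (f g : Fin m → Bool) → ∑ (λ j → b2ℤ (f j) * b2ℤ (g j)) ≡ + sumF 0 ℕ._+_
      (λ j → b2ℕ (f j) ℕ.* b2ℕ (g j))
    ∑-b2ℕ² {zero} f g = refl
    ∑-b2ℕ² {suc m} f g = cong₂ _+_ (b2ℤ≡ (f zero) (g zero)) (∑-b2ℕ² (f ∘ suc) (g ∘ suc))
      where
      b2ℤ≡ : ∀ b c → b2ℤ b * b2ℤ c ≡ + (b2ℕ b ℕ.* b2ℕ c)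
      b2ℤ≡ true true = refl
      b2ℤ≡ true false = refl
      b2ℤ≡ false true = refl
      b2ℤ≡ false false = refl

    ∑A : ∀ i → ∑ (A i) ≡ + k
    ∑A i = trans (∑-b2ℕ (G i)) (cong +_ (proj₁ (proj₂ srg) i))

    rows : ∀ i → ∑ (L i) ≡ + 0
    rows i = trans (ℤV.∑-cong (L≡ i)) (trans (ℤV.∑-+ (λ j → + k * δ i j) (λ j → - + 1 * A i j))
      (trans (cong₂ _+_ (trans (ℤV.∑-*ˡ (+ k) (δ i)) (cong (+ k *_) (∑-δ-row i)))
        (trans (ℤV.∑-*ˡ (- + 1) (A i)) (cong (- + 1 *_) (∑A i)))) (lem (+ k))))
      where
      lem : ∀ k → k * + 1 + - + 1 * k ≡ + 0
      lem = solve-∀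

    -- Entries of A² count common neighbours, and vertex degrees on the diagonal; the cases are
    -- equal, adjacent and non-adjacent vertices.
    A² : ∀ i j → ∑ (λ l → A i l * A l j) ≡ (+ k - + μ) * δ i j + (+ λ′ - + μ) * A i j + + μ
    A² i j = trans (ℤV.∑-cong (λ l → cong (A i l *_) (A-sym l j))) (by (i ≟ᶠ j) (G i j) refl)
      where
      idem : ∀ b → b2ℤ b * b2ℤ b ≡ b2ℤ b
      idem true = refl
      idem false = refl
      δ-eq : i ≡ j → δ i j ≡ + 1
      δ-eq i≡j = cong (λ b → if b then + 1 else + 0) (dec-true (i ≟ᶠ j) i≡j)
      δ-neq : i ≢ j → δ i j ≡ + 0
      δ-neq i≢j = cong (λ b → if b then + 1 else + 0) (dec-false (i ≟ᶠ j) i≢j)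
      lem₁ : ∀ k l m → k ≡ (k - m) * + 1 + (l - m) * + 0 + m
      lem₁ = solve-∀
      lem₂ : ∀ k l m → l ≡ (k - m) * + 0 + (l - m) * + 1 + m
      lem₂ = solve-∀
      lem₃ : ∀ k l m → m ≡ (k - m) * + 0 + (l - m) * + 0 + m
      lem₃ = solve-∀
      formula : ℤ → ℤ → ℤ
      formula d a = (+ k - + μ) * d + (+ λ′ - + μ) * a + + μ
      by : Dec (i ≡ j) → ∀ b → G i j ≡ b → ∑ (λ l → A i l * A j l) ≡ formula (δ i j) (A i j)
      by (yes refl) _ _ = trans (ℤV.∑-cong (λ l → idem (G i l))) (trans (∑A i) (trans (lem₁ (+ k) (+ λ′) (+ μ))
        (cong₂ formula (sym (δ-eq refl)) (cong b2ℤ (sym (proj₂ (proj₁ srg) i))))))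
      by (no i≢j) true Gij = trans (∑-b2ℕ² (G i) (G j))
        (trans (cong +_ (proj₁ (proj₂ (proj₂ srg)) i j i≢j Gij)) (trans (lem₂ (+ k) (+ λ′) (+ μ))
        (cong₂ formula (sym (δ-neq i≢j)) (cong b2ℤ (sym Gij)))))
      by (no i≢j) false Gij = trans (∑-b2ℕ² (G i) (G j))
        (trans (cong +_ (proj₂ (proj₂ (proj₂ srg)) i j i≢j Gij)) (trans (lem₃ (+ k) (+ λ′) (+ μ))
        (cong₂ formula (sym (δ-neq i≢j)) (cong b2ℤ (sym Gij)))))

    -- The coefficients in L² = τ L + κ₀ I + μ J, obtained by substituting A = k I - L in the
    -- relation for A². They turn out to be r + s and - r s.
    τ κ₀ : ℤ
    τ = + k + + k - (+ λ′ - + μ)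
    κ₀ = + k - + μ + (+ λ′ - + μ) * + k - + k * + k

    L² : ∀ i j → ∑ (λ l → L i l * L l j) ≡ τ * L i j + (κ₀ * δ i j + + μ)
    L² i j = trans (ℤV.∑-cong
      (λ l → trans (cong₂ _*_ (L≡ i l) (L≡ l j)) (expand (+ k) (δ i l) (A i l) (δ l j) (A l j))))
      (trans (ℤV.∑-+ (λ l → δ i l * (+ k * (+ k * δ l j + - + 1 * A l j)))
        (λ l → δ′ l * (- + k * A i l) + A i l * A l j))
      (trans (cong₂ _+_ (ℤV.∑-δ i (λ l → + k * (+ k * δ l j + - + 1 * A l j)))
        (trans (ℤV.∑-+ (λ l → δ′ l * (- + k * A i l)) (λ l → A i l * A l j))
          (cong₂ _+_ (trans (ℤV.∑-cong (λ l → cong (_* (- + k * A i l)) (ℤV.δ-sym l j)))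
            (ℤV.∑-δ j (λ l → - + k * A i l))) (A² i j))))
      (trans (collect (+ k) (+ λ′) (+ μ) (δ i j) (A i j))
        (cong (λ t → τ * t + (κ₀ * δ i j + + μ)) (sym (L≡ i j))))))
      where
      δ′ = λ l → δ l j
      expand : ∀ k d a d′ a′ → (k * d + - + 1 * a) * (k * d′ + - + 1 * a′) ≡ d * (k * (k * d′ + - + 1 * a′)) +
        (d′ * (- k * a) + a * a′)
      expand = solve-∀
      collect : ∀ k l m d a → k * (k * d + - + 1 * a) + (- k * a + ((k - m) * d + (l - m) * a + m))
                            ≡ (k + k - (l - m)) * (k * d + - + 1 * a) + ((k - m + (l - m) * k - k * k) * d + m)
      collect = solve-∀

    T : ZVec (suc n) → ZVec (suc n)
    T = mulMV L

    T𝟙 : ∀ i → T (λ _ → + 1) i ≡ + 0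
    T𝟙 i = trans (ℤV.∑-cong (λ j → ℤₚ.*-identityʳ (L i j))) (rows i)

    ∑T : ∀ x → ∑ (T x) ≡ + 0
    ∑T = ℤV.∑-mulMV L L-sym rows

    quadratic : ∀ x i → T (T x) i ≡ τ * T x i + (κ₀ * x i + + μ * ∑ x)
    quadratic = ℤV.mulMV-square L τ κ₀ (+ μ) L²

    -- The quadratic relation evaluated at the all-one vector, which `T` kills.
    κ₀+μv : κ₀ + + μ * + suc n ≡ + 0
    κ₀+μv = trans (lem τ κ₀ (+ μ * + suc n))
      (trans (cong₂ (λ s t → τ * s + (κ₀ * + 1 + + μ * t)) (sym (T𝟙 zero)) (sym (∑-ones (suc n))))
      (trans (sym (quadratic (λ _ → + 1) zero))
        (ℤV.∑-zero (λ j → trans (cong (L zero j *_) (T𝟙 j)) (ℤₚ.*-zeroʳ (L zero j))))))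
      where
      lem : ∀ τ κ m → κ + m ≡ τ * + 0 + (κ * + 1 + m)
      lem = solve-∀

    Lℚ : Fin (suc n) → Fin (suc n) → ℚ
    Lℚ i j = ι (L i j)

    Lℚ² : ∀ i j → ℚV.∑ (λ l → Lℚ i l ℚ.* Lℚ l j) ≡ ι τ ℚ.* Lℚ i j ℚ.+ (ι κ₀ ℚ.* ℚV.δ i j ℚ.+ ι (+ μ))
    Lℚ² i j = trans (sym (trans (ι-∑ (λ l → L i l * L l j)) (ℚV.∑-cong (λ l → ι-* (L i l) (L l j)))))
      (trans (cong ι (L² i j)) (trans (ι-+ (τ * L i j) (κ₀ * δ i j + + μ)) (cong₂ ℚ._+_ (ι-* τ (L i j))
        (trans (ι-+ (κ₀ * δ i j) (+ μ))
          (cong (ℚ._+ ι (+ μ)) (trans (ι-* κ₀ (δ i j)) (cong (ι κ₀ ℚ.*_) (ι-δ (does (i ≟ᶠ j))))))))))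
      where
      ι-δ : ∀ b → ι (if b then + 1 else + 0) ≡ (if b then 1ℚ else 0ℚ)
      ι-δ true = refl
      ι-δ false = refl

    Lℚ-sym : ∀ i j → Lℚ i j ≡ Lℚ j i
    Lℚ-sym i j = cong ι (L-sym i j)

    Lℚ-rows : ∀ i → ℚV.∑ (Lℚ i) ≡ 0ℚ
    Lℚ-rows i = trans (sym (ι-∑ (L i))) (cong ι (rows i))

    module ℚSpectrum = Spectrum Lℚ (ι τ) (ι κ₀) (ι (+ μ)) Lℚ² Lℚ-sym Lℚ-rows

    ι≢0 : ∀ {r} → r ≢ + 0 → ι r ≢ 0ℚ
    ι≢0 r≢0 e = r≢0 (ι-injective e)

    characteristic : ∀ {r f} → r ≢ + 0 → 1 ℕ.≤ f → EigenMult G k r f → r * r ≡ τ * r + κ₀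
    characteristic {r} {suc f} r≢0 _ dim = ι-injective
      (trans (ι-* r r) (trans (ℚSpectrum.characteristic (ι≢0 r≢0) dim)
      (sym (trans (ι-+ (τ * r) κ₀) (cong (ℚ._+ ι κ₀) (ι-* τ r))))))

    module Eigenvalues {r s : ℤ} {f g : ℕ} (r≢s : r ≢ s) (r≢0 : r ≢ + 0) (s≢0 : s ≢ + 0) (1≤f : 1 ℕ.≤ f)
      (1≤g : 1 ℕ.≤ g)
      (dim-r : EigenMult G k r f) (dim-s : EigenMult G k s g) where

      -- Both eigenvalues are roots of X² = τ X + κ₀; the difference of the two equations has the
      -- nonzero factor r - s.
      τ≡ : τ ≡ r + s
      τ≡ = by (ℤₚ.i*j≡0⇒i≡0∨j≡0 (r - s) product)
        where
        lem : ∀ r s τ κ → (r - s) * (r + s - τ) ≡ r * r - s * s - (τ * r + κ - (τ * s + κ))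
        lem = solve-∀
        lem′ : ∀ a b → a - b - (a - b) ≡ + 0
        lem′ = solve-∀
        product : (r - s) * (r + s - τ) ≡ + 0
        product = trans (lem r s τ κ₀)
          (trans (cong₂ (λ a b → a - b - (τ * r + κ₀ - (τ * s + κ₀))) (characteristic r≢0 1≤f dim-r)
          (characteristic s≢0 1≤g dim-s))
          (lem′ (τ * r + κ₀) (τ * s + κ₀)))
        by : r - s ≡ + 0 ⊎ r + s - τ ≡ + 0 → τ ≡ r + s
        by (inj₁ e) = ⊥-elim (r≢s (ℤₚ.i-j≡0⇒i≡j r s e))
        by (inj₂ e) = sym (ℤₚ.i-j≡0⇒i≡j (r + s) τ e)

      κ≡ : κ₀ ≡ - (r * s)
      κ≡ = trans (lem (τ * r) κ₀)
        (trans (cong₂ (λ a b → a - b * r) (sym (characteristic r≢0 1≤f dim-r)) τ≡) (lem′ r s))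
        where
        lem : ∀ a κ → κ ≡ a + κ - a
        lem = solve-∀
        lem′ : ∀ r s → r * r - (r + s) * r ≡ - (r * s)
        lem′ = solve-∀

      rs≡μv : + μ * + suc n ≡ r * s
      rs≡μv = trans (lem κ₀ (+ μ * + suc n)) (trans (cong₂ (λ a b → a - b) κ₀+μv κ≡) (lem′ (r * s)))
        where
        lem : ∀ κ m → m ≡ κ + m - κ
        lem = solve-∀
        lem′ : ∀ a → + 0 - - a ≡ a
        lem′ = solve-∀

      multiplicities : f ℕ.+ (g ℕ.+ 1) ≡ suc n
      multiplicities = ℚSpectrum.Multiplicities.multiplicities (ι≢0 r≢0) (ι≢0 s≢0) (λ e → r≢s (ι-injective e))
        (trans (cong ι τ≡) (ι-+ r s))
          (trans (cong ι κ≡) (trans (ι-neg (r * s)) (cong ℚ.-_ (ι-* r s)))) zero dim-r dim-s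

  module SylowSubgroup
    {n : ℕ} {G : Graph (suc n)} {k λ′ μ : ℕ} (srg : IsSRG G k λ′ μ)
    {r s : ℤ} {f g : ℕ} (r≢s : r ≢ s) (r≢0 : r ≢ + 0) (s≢0 : s ≢ + 0) (1≤f : 1 ℕ.≤ f) (1≤g : 1 ℕ.≤ g)
    (dim-r : EigenMult G k r f) (dim-s : EigenMult G k s g)
    {p : ℕ} (pp : Prime p) {e₀ : ℕ} (rank : RankModP G k p e₀)
    (p∣r : (+ p) ∣ℤ r) (p²∤r : ¬ (+ (p ℕ.* p)) ∣ℤ r) (p∣s : (+ p) ∣ℤ s) (p²∤s : ¬ (+ (p ℕ.* p)) ∣ℤ s)
    (γ : ℕ) (p^γ∣v : (p ℕ.^ γ) ℕD.∣ suc n) (p^γ+1∤v : ¬ (p ℕ.^ suc γ) ℕD.∣ suc n)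
    where

    open SRG srg
    open Eigenvalues r≢s r≢0 s≢0 1≤f 1≤g dim-r dim-s

    r≈0 = ∣⇒≈0 {+ p} {r} p∣r
    s≈0 = ∣⇒≈0 {+ p} {s} p∣s
    r′ = quot r≈0
    s′ = quot s≈0

    quotient≉0 : ∀ {x} (x≈0 : x ≈ + 0 [mod + p ]) → ¬ (+ (p ℕ.* p)) ∣ℤ x → ¬ quot x≈0 ≈ + 0 [mod + p ]
    quotient≉0 x≈0 p²∤x q≈0 = p²∤x
      (≈0⇒∣ {+ (p ℕ.* p)} (mod (quot q≈0) (trans (multiple x≈0) (trans (cong (+ p *_) (multiple q≈0))
      (trans (sym (ℤₚ.*-assoc (+ p) (+ p) (quot q≈0)))
        (trans (cong (_* quot q≈0) (sym (ℤₚ.pos-* p p))) (sym (ℤₚ.+-identityˡ _))))))))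

    u≉0 : ¬ r′ * s′ ≈ + 0 [mod + p ]
    u≉0 u≈0 = quotient≉0 s≈0 p²∤s (LinearAlgebra.cancel-unit (𝔽 pp) (quotient≉0 r≈0 p²∤r) u≈0)

    rs≡ : r * s ≡ + p * (+ p * (r′ * s′))
    rs≡ = trans (cong₂ _*_ (multiple r≈0) (multiple s≈0)) (lem (+ p) r′ s′)
      where
      lem : ∀ p r s → p * r * (p * s) ≡ p * (p * (r * s))
      lem = solve-∀

    quadratic′ : ∀ x i → T (T x) i ≡ + p * (r′ + s′) * T x i - + p * (+ p * (r′ * s′)) * x i + + μ * ∑ x
    quadratic′ x i = trans (quadratic x i) (trans (cong₂ (λ a b → a * T x i + (b * x i + + μ * ∑ x))
        (trans τ≡ (trans (cong₂ _+_ (multiple r≈0) (multiple s≈0)) (sym (ℤₚ.*-distribˡ-+ (+ p) r′ s′))))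
          (trans κ≡ (cong -_ rs≡)))
      (lem (+ p * (r′ + s′) * T x i) (+ p * (+ p * (r′ * s′))) (x i) (+ μ * ∑ x)))
      where
      lem : ∀ a b x m → a + (- b * x + m) ≡ a - b * x + m
      lem = solve-∀

    open Core L pp (r′ + s′) (r′ * s′) (+ μ) u≉0 quadratic′ ∑T T𝟙 public using (b; module WithRank)
    open WithRank (rank-𝔽 pp {M = L} rank) public using (a; size-N₀; φ; φ-torsion; φ-cong; φ-homo; φ-injective; φ-surjective; module Valuation)

    b+γ : b ℕ.+ γ ≡ e₀
    b+γ = Valuation.count (trans rs≡μv rs≡) γ p^γ∣v p^γ+1∤v

    -- The vertices are counted by the adapted basis mod p and by the rational eigenspaces. Adding
    -- `γ` to both counts turns `b` into `e₀`, and no subtraction occurs.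
    count : a ℕ.+ 2 ℕ.* e₀ ≡ f ℕ.+ g ℕ.+ γ
    count = ℕₚ.suc-injective (begin
      suc (a ℕ.+ 2 ℕ.* e₀)                  ≡⟨ lem a e₀ ⟩
      e₀ ℕ.+ (a ℕ.+ (e₀ ℕ.+ 1))             ≡⟨ cong (λ t → e₀ ℕ.+ (a ℕ.+ (t ℕ.+ 1))) b+γ ⟨
      e₀ ℕ.+ (a ℕ.+ (b ℕ.+ γ ℕ.+ 1))        ≡⟨ lem₁ e₀ a b γ ⟩
      e₀ ℕ.+ (a ℕ.+ (b ℕ.+ 1)) ℕ.+ γ        ≡⟨ cong (ℕ._+ γ) (trans size-N₀ (sym multiplicities)) ⟩
      f ℕ.+ (g ℕ.+ 1) ℕ.+ γ                 ≡⟨ lem₂ f g γ ⟩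
      suc (f ℕ.+ g ℕ.+ γ)                   ∎)
      where
      open ≡.≡-Reasoning
      open import Data.Nat.Solver using (module +-*-Solver)
      open +-*-Solver
      lem : ∀ a e → suc (a ℕ.+ 2 ℕ.* e) ≡ e ℕ.+ (a ℕ.+ (e ℕ.+ 1))
      lem = solve 2 (λ a e → con 1 :+ (a :+ con 2 :* e) := e :+ (a :+ (e :+ con 1))) refl
      lem₁ : ∀ e a b γ → e ℕ.+ (a ℕ.+ (b ℕ.+ γ ℕ.+ 1)) ≡ e ℕ.+ (a ℕ.+ (b ℕ.+ 1)) ℕ.+ γ
      lem₁ = solve 4 (λ e a b γ → e :+ (a :+ (b :+ γ :+ con 1)) := e :+ (a :+ (b :+ con 1)) :+ γ) refl
      lem₂ : ∀ f g γ → f ℕ.+ (g ℕ.+ 1) ℕ.+ γ ≡ suc (f ℕ.+ g ℕ.+ γ)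
      lem₂ = solve 3 (λ f g γ → f :+ (g :+ con 1) :+ γ := con 1 :+ (f :+ g :+ γ)) refl

    sylowIso : SylowIso G k p a b
    -- The exponent 2 serves for every element, since p² kills the image of `φ`.
    sylowIso = φ , (λ t → 2 , φ-torsion t) , φ-cong , φ-homo , φ-injective , φ-surjective

open StronglyRegular

open import Data.Nat using (_+_; _*_; _^_; _≤_)
open import Data.Nat.Divisibility using (_∣_)

theorem3p5 : (v k λ' μ : ℕ) (G : Graph v) → IsSRG G k λ' μ → Connected G →
    (r s : ℤ) (f g : ℕ) → r ≢ s → r ≢ + 0 → s ≢ + 0 →
    1 ≤ f → 1 ≤ g → EigenMult G k r f → EigenMult G k s g →
    (p : ℕ) → Prime p →
    (Σ ℕ λ n → CritOrder G k n × (p ∣ n)) →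
    (e₀ : ℕ) → RankModP G k p e₀ →
    (+ p) ∣ℤ r → ¬ ((+ (p * p)) ∣ℤ r) →
    (+ p) ∣ℤ s → ¬ ((+ (p * p)) ∣ℤ s) →
    (γ : ℕ) → (p ^ γ) ∣ v → ¬ ((p ^ suc γ) ∣ v) →
    Σ ℕ λ a → Σ ℕ λ b →
    (a + 2 * e₀ ≡ f + g + γ) × (b + γ ≡ e₀) × SylowIso G k p a b
theorem3p5 zero k λ' μ G srg _ r s f g _ _ _ _ _ _ _ p pp _ e₀ _ _ _ _ _ γ _ p^γ+1∤v =
  -- Every power of p divides 0, so without vertices there is no exact exponent `γ`.
  ⊥-elim (p^γ+1∤v ((p ^ suc γ) ℕD.∣0))
theorem3p5 (suc n) k λ' μ G srg _ r s f g r≢s r≢0 s≢0 1≤f 1≤g dim-r dim-s p pp _ e₀ rank p∣r p²∤r p∣s p²∤s γ p^γ∣v p^γ+1∤v =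
  a , b , count , b+γ , sylowIso
  where
  open SylowSubgroup srg r≢s r≢0 s≢0 1≤f 1≤g dim-r dim-s pp rank p∣r p²∤r p∣s p²∤s γ p^γ∣v p^γ+1∤v
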